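{- Let $\phi(p)\in\mathrm{SO}_{d[0,1]}(\mathrm{SUM},\times)$ be a formula (with $p$ a $k$-ary function variable, its only free variable) of the form $Q_1f_1\dots Q_nf_n\forall\bar x\,\theta$, where each $Q_i\in\{\exists,\forall\}$, $\theta$ is quantifier-free, and every numerical identity atom of $\theta$ (possibly negated) has the form $f_i(\bar u\bar v)=f_j(\bar u)\times f_k(\bar v)$ or $f_i(\bar u)=\mathrm{SUM}_{\bar v}f_j(\bar u\bar v)$ for distinct $f_i,f_j,f_k\in\{f_1,\dots,f_n,p\}$. Then there is a formula $\Phi\in\mathrm{FO}(\perp\!\!\!\perp_c,\sim,\approx)$ with free variables among $v_1,\dots,v_k$ such that for all finite structures $\mathcal A$ and all probability distributions $p^{\mathcal A}$ on $A^k$, letting $\mathbb X$ be the probabilistic team over $\{v_1,\dots,v_k\}$ with $\mathbb X(s)=p^{\mathcal A}(s(v_1),\dots,s(v_k))$: $\mathcal A\models_{\mathbb X}\Phi$ iff $(\mathcal A,p^{\mathcal A})\models\phi$.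
   Context: Probabilistic team semantics. Fix a finite relational vocabulary $\tau$ containing $=$; structures $\mathcal A$ are finite $\tau$-structures with universe $A$. An assignment over a finite set $D$ of variables is a map $s\colon D\to A$; $s(a/x)$ maps $x$ to $a$ and agrees with $s$ elsewhere. A probabilistic team over $D$ is $\mathbb X\colon X\to[0,1]$ with $\sum_{s\in X}\mathbb X(s)=1$, $X$ a finite set of assignments over $D$; $\mathrm{supp}(\mathbb X)=\{s:\mathbb X(s)\ne0\}$; $|\mathbb X_{\bar x=\bar a}|=\sum_{s(\bar x)=\bar a}\mathbb X(s)$. $\mathbb X(F/x)(s(a/x))=\sum_{t\in X,\ t(a/x)=s(a/x)}\mathbb X(t)F(t)(a)$ for $F$ assigning to each $t\in X$ a distribution on $A$; $\mathbb X(A/x)$ uses uniform $F(t)$; $\mathbb Y\sqcup_k\mathbb Z$ is $s\mapsto k\mathbb Y(s)+(1-k)\mathbb Z(s)$. Syntax of $\mathrm{FO}(\perp\!\!\!\perp_c,\sim,\approx)$: $\phi::=R(\bar x)\mid\neg R(\bar x)\mid\bar y\perp\!\!\!\perp_{\bar x}\bar z\mid\bar x\approx\bar y\mid\sim\phi\mid\phi\wedge\phi\mid\phi\vee\phi\mid\exists x\phi\mid\forall x\phi$. Semantics: literals hold in $\mathbb X$ iff every $s\in\mathrm{supp}(\mathbb X)$ satisfies them; $\bar y\perp\!\!\!\perp_{\bar x}\bar z$ holds iff $|\mathbb X_{\bar x\bar y=s(\bar x\bar y)}|\cdot|\mathbb X_{\bar x\bar z=s(\bar x\bar z)}|=|\mathbb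 X_{\bar x\bar y\bar z=s(\bar x\bar y\bar z)}|\cdot|\mathbb X_{\bar x=s(\bar x)}|$ for all $s\colon\mathrm{Var}(\bar x\bar y\bar z)\to A$; $\bar x\approx\bar y$ (equal lengths) holds iff $|\mathbb X_{\bar x=\bar a}|=|\mathbb X_{\bar y=\bar a}|$ for all $\bar a$; $\sim$ is Boolean negation; $\wedge$ classical; $\phi\vee\psi$ holds in $\mathbb X$ iff $\phi$ holds in $\mathbb Y$ and $\psi$ in $\mathbb Z$ for some $\mathbb Y,\mathbb Z,k$ with $\mathbb Y\sqcup_k\mathbb Z=\mathbb X$; $\exists x\phi$ holds iff $\phi$ holds in some $\mathbb X(F/x)$; $\forall x\phi$ holds iff $\phi$ holds in $\mathbb X(A/x)$. $\mathrm{SO}_{d[0,1]}(\mathrm{SUM},\times)$: over expansions of finite $\tau$-structures by real-valued functions, numerical terms $i::=f(\bar x)\mid i\times i\mid\mathrm{SUM}_{\bar y}i$ ($\mathrm{SUM}_{\bar y}i$ sums $i$ over all values $\bar b\in A^{|\bar y|}$ of $\bar y$), formulas $i=j\mid\neg i=j\mid R(\bar x)\mid\neg R(\bar x)\mid\wedge\mid\vee\mid\exists x\mid\forall x\mid\exists f\mid\forall f$, first-order quantifiers over $A$, function quantifiers over probability distributions on $A^{\mathrm{Ar}(f)}$. -}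

module Defs where

open import Level using (0ℓ)
open import Algebra.Bundles using (CommutativeRing)
import Algebra.Properties.CommutativeMonoid.Sum as Summation
import Algebra.Properties.Semiring.Mult as Multiples
open import Data.Bool.Base using (if_then_else_)
open import Data.Fin.Base using (Fin; zero; _↑ˡ_; _↑ʳ_)
import Data.Fin.Properties as Fin
open import Data.List.Base using (List; []; _∷_)
open import Data.List.Membership.Propositional using (_∈_)
open import Data.List.Relation.Unary.All using (All; []; _∷_)
import Data.List.Relation.Unary.All as All
open import Data.List.Relation.Unary.Any using (index)
open import Data.Nat.Base as ℕ using (ℕ; zero; suc; NonZero)
open import Data.Product.Base using (Σ; ∃; _×_)
open import Data.Sum.Base using (_⊎_)
open import Data.Vec.Base using (Vec; []; _∷_; _++_; _[_]≔_; lookup; map; allFin)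
import Data.Vec.Properties as Vec
open import Function.Base using (_∘_)
open import Function.Bundles using (_↔_; Inverse)
open import Function.Properties.Inverse using (↔⇒↣)
open import Relation.Binary.Definitions using (DecidableEquality)
open import Relation.Binary.PropositionalEquality.Core using (_≡_; _≢_)
open import Relation.Binary.Structures using (IsTotalOrder)
open import Relation.Nullary.Decidable using (does; via-injection)
open import Relation.Nullary.Negation using (¬_)
open import Relation.Unary using (Pred)

------------------------------------------------------------------------
-- The real numbers

-- The standard library has no real numbers.  They are axiomatised as a
-- Dedekind-complete ordered field, which (classically) determines them
-- up to isomorphism.  The value of _⁻¹ at 0# is unspecified.

record RealNumbers : Set₁ where
  infix  8 _⁻¹
  infix  4 _≤_
  field
    commutativeRing : CommutativeRing 0ℓ 0ℓ

  open CommutativeRing commutativeRing public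
    renaming (Carrier to ℝ)

  field
    _⁻¹          : ℝ → ℝ
    _≤_          : ℝ → ℝ → Set
    0≉1          : ¬ (0# ≈ 1#)
    *-inverseʳ   : ∀ {x} → ¬ (x ≈ 0#) → x * x ⁻¹ ≈ 1#
    isTotalOrder : IsTotalOrder _≈_ _≤_
    +-monoˡ-≤    : ∀ {x y} z → x ≤ y → x + z ≤ y + z
    *-nonNeg     : ∀ {x y} → 0# ≤ x → 0# ≤ y → 0# ≤ x * y
    supremum     : (S : Pred ℝ 0ℓ) → ∃ S →
                   (∃ λ b → ∀ x → S x → x ≤ b) →
                   ∃ λ l → (∀ x → S x → x ≤ l) ×
                           (∀ b → (∀ x → S x → x ≤ b) → l ≤ b)

------------------------------------------------------------------------
-- Finite relational structures

-- The arities of the relation symbols other than equality.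
Vocabulary : Set
Vocabulary = List ℕ

data Symbol (τ : Vocabulary) : ℕ → Set where
  equality : Symbol τ 2
  symbol   : ∀ {r} → r ∈ τ → Symbol τ r

record Structure (τ : Vocabulary) : Set₁ where
  field
    Universe     : Set
    size         : ℕ
    {{nonEmpty}} : NonZero size
    finite       : Universe ↔ Fin size
    relation     : ∀ {r} → r ∈ τ → Pred (Vec Universe r) 0ℓ

  data Equal : Pred (Vec Universe 2) 0ℓ where
    equal : ∀ a → Equal (a ∷ a ∷ [])

  interpret : ∀ {r} → Symbol τ r → Pred (Vec Universe r) 0ℓ
  interpret equality   = Equal
  interpret (symbol R) = relation R

  _≟_ : DecidableEquality Universe
  _≟_ = via-injection (↔⇒↣ finite) Fin._≟_

-- Assignments of values in A to n variables.
Assignment : Set → ℕ → Set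
Assignment A n = Vec A n

_⟦_⟧ : ∀ {A : Set} {n r} → Assignment A n → Vec (Fin n) r → Vec A r
s ⟦ xs ⟧ = map (lookup s) xs

------------------------------------------------------------------------
-- Syntax of FO(⊥⊥c, ∼, ≈)

-- A finite set of n variables is identified with Fin n.  The variable
-- of a quantifier is either one of these n variables, whose old value is
-- then overwritten, or a new one, which becomes the variable zero.
data Binder (n : ℕ) : ℕ → Set where
  old : Fin n → Binder n n
  new : Binder n (suc n)

bound : ∀ {n m} → Binder n m → Fin m
bound (old x) = x
bound new     = zero

_[_/_] : ∀ {A : Set} {n m} → Assignment A n → A → Binder n m → Assignment A m
s [ a / old x ] = s [ x ]≔ a
s [ a / new   ] = a ∷ s

module FO (τ : Vocabulary) where

  infixr 6 _∧_
  infixr 5 _∨_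
  infix  7 _≈_

  -- Formulas whose free variables are among n variables;
  -- indep x y z stands for  y ⊥⊥_x z.
  data Formula (n : ℕ) : Set where
    rel ¬rel : ∀ {r} → Symbol τ r → Vec (Fin n) r → Formula n
    indep    : ∀ {a b c} →
               Vec (Fin n) a → Vec (Fin n) b → Vec (Fin n) c → Formula n
    _≈_      : ∀ {r} → Vec (Fin n) r → Vec (Fin n) r → Formula n
    ∼_       : Formula n → Formula n
    _∧_ _∨_  : Formula n → Formula n → Formula n
    ex all   : ∀ {m} → Binder n m → Formula m → Formula n

------------------------------------------------------------------------
-- Syntax of SO_d[0,1](SUM, ×)

module SO (τ : Vocabulary) where

  infix  8 _==_ _!=_
  infixr 9 _⊗_
  infixr 6 _∧_
  infixr 5 _∨_

  -- Γ lists the arities of the function variables, n counts the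
  -- first-order variables in scope.  In SUM m i the m bound variables
  -- are the first m variables of i.
  data Term (Γ : List ℕ) (n : ℕ) : Set where
    app : ∀ {r} → r ∈ Γ → Vec (Fin n) r → Term Γ n
    _⊗_ : Term Γ n → Term Γ n → Term Γ n
    SUM : ∀ m → Term Γ (m ℕ.+ n) → Term Γ n

  data Formula (Γ : List ℕ) (n : ℕ) : Set where
    _==_ _!=_ : Term Γ n → Term Γ n → Formula Γ n
    rel ¬rel  : ∀ {r} → Symbol τ r → Vec (Fin n) r → Formula Γ n
    _∧_ _∨_   : Formula Γ n → Formula Γ n → Formula Γ n
    ex all    : Formula Γ (suc n) → Formula Γ n
    exF allF  : ∀ r → Formula (r ∷ Γ) n → Formula Γ n

  Distinct : ∀ {Γ : List ℕ} {r r′} → r ∈ Γ → r′ ∈ Γ → Set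
  Distinct f g = index f ≢ index g

  -- The terms i and j of the identities allowed in the matrix.
  data Identity {Γ : List ℕ} {n : ℕ} : Term Γ n → Term Γ n → Set where
    -- f(u v) = g(u) × h(v)
    product : ∀ {a b} (f : (a ℕ.+ b) ∈ Γ) (g : a ∈ Γ) (h : b ∈ Γ) →
              Distinct f g → Distinct f h → Distinct g h →
              (u : Vec (Fin n) a) (v : Vec (Fin n) b) →
              Identity (app f (u ++ v)) (app g u ⊗ app h v)
    -- f(u) = SUM_v g(u v)
    marginal : ∀ {a b} (f : a ∈ Γ) (g : (a ℕ.+ b) ∈ Γ) →
               Distinct f g →
               (u : Vec (Fin n) a) →
               Identity (app f u)
                        (SUM b (app g (map (b ↑ʳ_) u ++ map (_↑ˡ n) (allFin b))))

  data Matrix {Γ : List ℕ} {n : ℕ} : Formula Γ n → Set where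
    _==_ : ∀ {i j} → Identity i j → Matrix (i == j)
    _!=_ : ∀ {i j} → Identity i j → Matrix (i != j)
    rel  : ∀ {r} (R : Symbol τ r) (xs : Vec (Fin n) r) → Matrix (rel R xs)
    ¬rel : ∀ {r} (R : Symbol τ r) (xs : Vec (Fin n) r) → Matrix (¬rel R xs)
    _∧_  : ∀ {θ χ} → Matrix θ → Matrix χ → Matrix (θ ∧ χ)
    _∨_  : ∀ {θ χ} → Matrix θ → Matrix χ → Matrix (θ ∨ χ)

  data Universal {Γ : List ℕ} {n : ℕ} : Formula Γ n → Set where
    matrix : ∀ {θ} → Matrix θ → Universal θ
    all    : ∀ {φ} → Universal φ → Universal (all φ)

  -- Q₁f₁ … Qₙfₙ ∀x₁ … ∀xₘ θ
  data Prenex {Γ : List ℕ} {n : ℕ} : Formula Γ n → Set where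
    universal : ∀ {φ} → Universal φ → Prenex φ
    exF       : ∀ {r φ} → Prenex φ → Prenex (exF r φ)
    allF      : ∀ {r φ} → Prenex φ → Prenex (allF r φ)

------------------------------------------------------------------------
-- Semantics

module Semantics (reals : RealNumbers) {τ : Vocabulary} (𝒜 : Structure τ) where

  open RealNumbers reals
  open Structure 𝒜 renaming (Universe to A)
  open Summation +-commutativeMonoid using (sum)
  open Multiples semiring using () renaming (_×_ to _·_)

  ∑ : (A → ℝ) → ℝ
  ∑ w = sum (w ∘ Inverse.from finite)

  ∑ⁿ : ∀ {n} → (Vec A n → ℝ) → ℝ
  ∑ⁿ {zero}  w = w []
  ∑ⁿ {suc n} w = ∑ λ a → ∑ⁿ λ as → w (a ∷ as)

  -- That all values are at most 1 follows.
  IsDistributionᴬ : (A → ℝ) → Set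
  IsDistributionᴬ w = (∀ a → 0# ≤ w a) × ∑ w ≈ 1#

  IsDistribution : ∀ {n} → (Vec A n → ℝ) → Set
  IsDistribution w = (∀ as → 0# ≤ w as) × ∑ⁿ w ≈ 1#

  module _ where
    open FO τ using (Formula; rel; ¬rel; indep; ∼_; _∧_; _∨_; ex; all)

    -- A probabilistic team is a function 𝕏 : Weights n that satisfies
    -- IsDistribution; assignments outside a given finite set X of
    -- assignments have weight 0.  All clauses of _⊨_ pass from
    -- probabilistic teams to probabilistic teams.
    Weights : ℕ → Set
    Weights n = Assignment A n → ℝ

    _∈supp_ : ∀ {n} → Assignment A n → Weights n → Set
    s ∈supp 𝕏 = ¬ (𝕏 s ≈ 0#)

    _≟ⁿ_ : ∀ {n} → DecidableEquality (Vec A n)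
    _≟ⁿ_ = Vec.≡-dec _≟_

    -- ∣ 𝕏 [ x ≔ a ]∣ is the total weight of the s with s(x) = a.
    ∣_[_≔_]∣ : ∀ {n r} → Weights n → Vec (Fin n) r → Vec A r → ℝ
    ∣ 𝕏 [ xs ≔ as ]∣ =
      ∑ⁿ λ s → if does ((s ⟦ xs ⟧) ≟ⁿ as) then 𝕏 s else 0#

    -- 𝕏(F/x), where every assignment s to the variables including x is
    -- of the form s(a/x) for a = s(x).
    _⟨_/_⟩ : ∀ {n m} →
             Weights n → (Assignment A n → A → ℝ) → Binder n m → Weights m
    (𝕏 ⟨ F / x ⟩) s =
      ∑ⁿ λ t → if does ((t [ a / x ]) ≟ⁿ s) then 𝕏 t * F t a else 0#
      where a = lookup s (bound x)

    uniform : ∀ {n} → Assignment A n → A → ℝ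
    uniform _ _ = (size · 1#) ⁻¹

    mix : ∀ {n} → ℝ → Weights n → Weights n → Weights n
    mix k 𝕐 ℤ s = k * 𝕐 s + (1# - k) * ℤ s

    infix 3 _⊨_
    _⊨_ : ∀ {n} → Weights n → Formula n → Set
    𝕏 ⊨ rel R xs  = ∀ s → s ∈supp 𝕏 → interpret R (s ⟦ xs ⟧)
    𝕏 ⊨ ¬rel R xs = ∀ s → s ∈supp 𝕏 → ¬ interpret R (s ⟦ xs ⟧)
    𝕏 ⊨ indep x y z = ∀ s →
      ∣ 𝕏 [ x ++ y ≔ s ⟦ x ++ y ⟧ ]∣ * ∣ 𝕏 [ x ++ z ≔ s ⟦ x ++ z ⟧ ]∣ ≈
      ∣ 𝕏 [ x ++ y ++ z ≔ s ⟦ x ++ y ++ z ⟧ ]∣ * ∣ 𝕏 [ x ≔ s ⟦ x ⟧ ]∣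
    𝕏 ⊨ xs FO.≈ ys = ∀ as → ∣ 𝕏 [ xs ≔ as ]∣ ≈ ∣ 𝕏 [ ys ≔ as ]∣
    𝕏 ⊨ ∼ φ    = ¬ (𝕏 ⊨ φ)
    𝕏 ⊨ φ ∧ ψ  = (𝕏 ⊨ φ) × (𝕏 ⊨ ψ)
    𝕏 ⊨ φ ∨ ψ  =
      Σ (Weights _) λ 𝕐 → Σ (Weights _) λ ℤ → Σ ℝ λ k →
        IsDistribution 𝕐 × IsDistribution ℤ × 0# ≤ k × k ≤ 1# ×
        (∀ s → mix k 𝕐 ℤ s ≈ 𝕏 s) × (𝕐 ⊨ φ) × (ℤ ⊨ ψ)
    𝕏 ⊨ ex x φ =
      Σ (Assignment A _ → A → ℝ) λ F →
        (∀ s → IsDistributionᴬ (F s)) × (𝕏 ⟨ F / x ⟩ ⊨ φ)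
    𝕏 ⊨ all x φ = 𝕏 ⟨ uniform / x ⟩ ⊨ φ

    -- The team over k variables v with weights 𝕏(s) = p(s(v)).
    team : ∀ {k} → (Vec A k → ℝ) → Weights k
    team p s = p (s ⟦ allFin _ ⟧)

  module _ where
    open SO τ

    Functions : List ℕ → Set
    Functions = All (λ r → Vec A r → ℝ)

    value : ∀ {Γ n} → Functions Γ → Assignment A n → Term Γ n → ℝ
    value ρ s (app f xs) = All.lookup ρ f (s ⟦ xs ⟧)
    value ρ s (i ⊗ j)    = value ρ s i * value ρ s j
    value ρ s (SUM m i)  = ∑ⁿ {m} λ bs → value ρ (bs ++ s) i

    infix 3 _,_⊩_
    _,_⊩_ : ∀ {Γ n} → Functions Γ → Assignment A n → Formula Γ n → Set
    ρ , s ⊩ i == j    = value ρ s i ≈ value ρ s j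
    ρ , s ⊩ i != j    = ¬ (value ρ s i ≈ value ρ s j)
    ρ , s ⊩ rel R xs  = interpret R (s ⟦ xs ⟧)
    ρ , s ⊩ ¬rel R xs = ¬ interpret R (s ⟦ xs ⟧)
    ρ , s ⊩ φ ∧ ψ     = (ρ , s ⊩ φ) × (ρ , s ⊩ ψ)
    ρ , s ⊩ φ ∨ ψ     = (ρ , s ⊩ φ) ⊎ (ρ , s ⊩ ψ)
    ρ , s ⊩ ex φ      = Σ A λ a → ρ , a ∷ s ⊩ φ
    ρ , s ⊩ all φ     = ∀ a → ρ , a ∷ s ⊩ φ
    ρ , s ⊩ exF r φ   =
      Σ (Vec A r → ℝ) λ f → IsDistribution f × (f ∷ ρ , s ⊩ φ)
    ρ , s ⊩ allF r φ  =
      (f : Vec A r → ℝ) → IsDistribution f → (f ∷ ρ , s ⊩ φ)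

{-# OPTIONS --safe #-}

-- An r-ary function variable becomes a block of r team variables whose
-- joint distribution is the function.  Quantifying a block ranges over
-- all teams with the given marginal on the old variables, so ∃f becomes
-- a block of ∃ and ∀f its dual; only the marginals of the single blocks
-- matter, not how the blocks are correlated.  A first-order variable x
-- becomes a variable that is constant on the support (x ⊥⊥ x), so that
-- ∀x θ becomes ∼∃x (x ⊥⊥ x ∧ ∼θ) and the matrix, evaluated at a single
-- point, needs only Boolean connectives.  For f(uv) = g(u) × h(v) one
-- quantifies independent copies of the blocks of g and h, for a marginal
-- one takes a part of the block of g; either way it remains to say that
-- two tuples xs and ys take a given constant value zs with the same
-- probability.  This holds iff some copy of xs equals zs exactly where
-- ys does: outside the event ys = zs, let the copy follow the
-- distribution of xs conditioned on being distinct from zs.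

module Submission where

open import Defs
open import Level using (0ℓ)
open import Axiom.ExcludedMiddle using (ExcludedMiddle)
open import Axiom.DoubleNegationElimination using (em⇒dne)
import Algebra.Properties.Semiring.Sum as SemiringSum
import Algebra.Properties.Ring as RingProperties
open import Data.Bool.Base using (if_then_else_)
open import Data.Empty using (⊥-elim)
open import Data.Fin.Base using (Fin; zero; suc; _↑ˡ_; _↑ʳ_)
open import Data.List.Base using (List; []; _∷_)
open import Data.List.Membership.Propositional using (_∈_)
open import Data.List.Relation.Unary.All using (All; []; _∷_)
import Data.List.Relation.Unary.All as All
import Data.List.Relation.Unary.All.Properties as All
open import Data.List.Relation.Unary.Any using (here; there)
open import Data.Nat.Base as ℕ using (ℕ; zero; suc)
open import Data.Product.Base using (Σ; ∃; _×_; _,_; proj₁; proj₂)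
open import Data.Product.Function.NonDependent.Propositional using (_×-⇔_)
open import Data.Sum.Base using (_⊎_; inj₁; inj₂)
open import Data.Sum.Function.Propositional using (_⊎-⇔_)
open import Data.Unit.Base using (tt)
open import Data.Vec.Base
  using (Vec; []; _∷_; _++_; lookup; map; allFin; take; drop; head; splitAt)
import Data.Vec.Properties as Vec
open import Function.Base using (_∘_)
open import Function.Bundles using (_⇔_; Equivalence; Inverse; mk⇔)
open import Function.Construct.Composition using (_⇔-∘_)
open import Relation.Binary.PropositionalEquality as ≡ using (_≡_; _≢_)
import Relation.Binary.Reasoning.Setoid as SetoidReasoning
open import Relation.Binary.Structures using (IsTotalOrder)
open import Relation.Nullary.Decidable using (Dec; yes; no; does; dec-true; dec-false; ¬?)
open import Relation.Nullary.Negation using (¬_; contradiction)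

-- Arithmetic in an ordered field

module Order (reals : RealNumbers) where

  open RealNumbers reals hiding (zero)
  open IsTotalOrder isTotalOrder public
    using (antisym; total; ≤-respˡ-≈; ≤-respʳ-≈)
    renaming (reflexive to ≤-reflexive; trans to ≤-trans)
  open RingProperties ring using (-‿distribˡ-*; -‿distribʳ-*; -‿involutive)
  open SetoidReasoning setoid

  ≤-refl : ∀ {x} → x ≤ x
  ≤-refl = ≤-reflexive refl

  x≤x+y : ∀ x {y} → 0# ≤ y → x ≤ x + y
  x≤x+y x {y} 0≤y =
    ≤-respˡ-≈ (+-identityˡ x) (≤-respʳ-≈ (+-comm y x) (+-monoˡ-≤ x 0≤y))

  +-nonNeg : ∀ {x y} → 0# ≤ x → 0# ≤ y → 0# ≤ x + y
  +-nonNeg {x} 0≤x 0≤y = ≤-trans 0≤x (x≤x+y x 0≤y)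

  +-zeroˡ⁻ : ∀ {x y} → 0# ≤ x → 0# ≤ y → x + y ≈ 0# → x ≈ 0#
  +-zeroˡ⁻ {x} 0≤x 0≤y x+y≈0 = antisym (≤-respʳ-≈ x+y≈0 (x≤x+y x 0≤y)) 0≤x

  square-nonNeg : ∀ x → 0# ≤ x * x
  square-nonNeg x with total 0# x
  ... | inj₁ 0≤x = *-nonNeg 0≤x 0≤x
  ... | inj₂ x≤0 = ≤-respʳ-≈ -x*-x≈x*x (*-nonNeg 0≤-x 0≤-x)
    where
    0≤-x : 0# ≤ - x
    0≤-x = ≤-respˡ-≈ (-‿inverseʳ x) (≤-respʳ-≈ (+-identityˡ (- x)) (+-monoˡ-≤ (- x) x≤0))
    -x*-x≈x*x : - x * - x ≈ x * x
    -x*-x≈x*x = begin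
      - x * - x     ≈⟨ -‿distribˡ-* x (- x) ⟨
      - (x * - x)   ≈⟨ -‿cong (-‿distribʳ-* x x) ⟨
      - - (x * x)   ≈⟨ -‿involutive (x * x) ⟩
      x * x         ∎

  0≤1 : 0# ≤ 1#
  0≤1 = ≤-respʳ-≈ (*-identityˡ 1#) (square-nonNeg 1#)

  *-inverseˡ : ∀ {x} → ¬ (x ≈ 0#) → x ⁻¹ * x ≈ 1#
  *-inverseˡ {x} x≉0 = trans (*-comm _ _) (*-inverseʳ x≉0)

  -- For nonzero `x`, the inverse is `x` times the square of `x ⁻¹`, a product of nonnegative
  -- factors.
  ⁻¹-nonNeg : ∀ {x} → 0# ≤ x → ¬ (x ≈ 0#) → 0# ≤ x ⁻¹
  ⁻¹-nonNeg {x} 0≤x x≉0 = ≤-respʳ-≈ eq (*-nonNeg 0≤x (square-nonNeg (x ⁻¹)))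
    where
    eq : x * (x ⁻¹ * x ⁻¹) ≈ x ⁻¹
    eq = begin
      x * (x ⁻¹ * x ⁻¹)   ≈⟨ *-assoc _ _ _ ⟨
      x * x ⁻¹ * x ⁻¹     ≈⟨ *-congʳ (*-inverseʳ x≉0) ⟩
      1# * x ⁻¹           ≈⟨ *-identityˡ _ ⟩
      x ⁻¹                ∎

  cancel-÷ : ∀ x {y} → ¬ (y ≈ 0#) → y * (x * y ⁻¹) ≈ x
  cancel-÷ x {y} y≉0 = begin
    y * (x * y ⁻¹)   ≈⟨ *-congˡ (*-comm _ _) ⟩
    y * (y ⁻¹ * x)   ≈⟨ *-assoc _ _ _ ⟨
    y * y ⁻¹ * x     ≈⟨ *-congʳ (*-inverseʳ y≉0) ⟩
    1# * x           ≈⟨ *-identityˡ x ⟩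
    x                ∎

  x+y≈z⇒y≈z-x : ∀ {x y z} → x + y ≈ z → y ≈ z - x
  x+y≈z⇒y≈z-x {x} {y} {z} x+y≈z = begin
    y               ≈⟨ +-identityʳ y ⟨
    y + 0#          ≈⟨ +-congˡ (-‿inverseʳ x) ⟨
    y + (x - x)     ≈⟨ +-assoc _ _ _ ⟨
    y + x - x       ≈⟨ +-congʳ (trans (+-comm _ _) x+y≈z) ⟩
    z - x           ∎

  +-cancelˡ-0 : ∀ {x y} → x + y ≈ x → y ≈ 0#
  +-cancelˡ-0 {x} x+y≈x = trans (x+y≈z⇒y≈z-x x+y≈x) (-‿inverseʳ x)

  -- Used for tuples independent of themselves: the probability of each of their values is
  -- idempotent.
  *-cancelˡ-1 : ∀ {x} → ¬ (x ≈ 0#) → x * x ≈ x → x ≈ 1#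
  *-cancelˡ-1 {x} x≉0 xx≈x = begin
    x                ≈⟨ *-identityˡ x ⟨
    1# * x           ≈⟨ *-congʳ (*-inverseˡ x≉0) ⟨
    x ⁻¹ * x * x     ≈⟨ *-assoc _ _ _ ⟩
    x ⁻¹ * (x * x)   ≈⟨ *-congˡ xx≈x ⟩
    x ⁻¹ * x         ≈⟨ *-inverseˡ x≉0 ⟩
    1#               ∎

-- Iterated sums over the universe

module Sums (reals : RealNumbers) {τ : Vocabulary} (𝒜 : Structure τ) where

  open RealNumbers reals hiding (zero)
  open Order reals
  open Structure 𝒜 using (size; finite) renaming (Universe to A)
  open Semantics reals 𝒜
  open SemiringSum semiring
    using (sum; sum-cong-≋; ∑-distrib-+; ∑-comm; *-distribˡ-sum)
  open SetoidReasoning setoid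

  private
    to = Inverse.to finite
    from = Inverse.from finite

    sum-nonNeg : ∀ {m} (w : Fin m → ℝ) → (∀ i → 0# ≤ w i) → 0# ≤ sum w
    sum-nonNeg {zero}  w 0≤w = ≤-refl
    sum-nonNeg {suc m} w 0≤w = +-nonNeg (0≤w zero) (sum-nonNeg (w ∘ suc) (0≤w ∘ suc))

    sum-zero : ∀ {m} (w : Fin m → ℝ) → (∀ i → w i ≈ 0#) → sum w ≈ 0#
    sum-zero {zero}  w w≈0 = refl
    sum-zero {suc m} w w≈0 =
      trans (+-cong (w≈0 zero) (sum-zero (w ∘ suc) (w≈0 ∘ suc))) (+-identityˡ 0#)

    sum-zero⁻ : ∀ {m} (w : Fin m → ℝ) → (∀ i → 0# ≤ w i) → sum w ≈ 0# → ∀ i → w i ≈ 0#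
    sum-zero⁻ w 0≤w eq zero    = +-zeroˡ⁻ (0≤w zero) (sum-nonNeg (w ∘ suc) (0≤w ∘ suc)) eq
    sum-zero⁻ w 0≤w eq (suc i) = sum-zero⁻ (w ∘ suc) (0≤w ∘ suc)
      (+-zeroˡ⁻ (sum-nonNeg (w ∘ suc) (0≤w ∘ suc)) (0≤w zero) (trans (+-comm _ _) eq)) i

    sum-single : ∀ {m} (w : Fin m → ℝ) i → (∀ j → j ≢ i → w j ≈ 0#) → sum w ≈ w i
    sum-single w zero    w≈0 =
      trans (+-congˡ (sum-zero (w ∘ suc) (λ j → w≈0 (suc j) (λ ())))) (+-identityʳ _)
    sum-single w (suc i) w≈0 =
      trans (+-cong (w≈0 zero (λ ()))
                    (sum-single (w ∘ suc) i (λ j j≢i → w≈0 (suc j) (λ { ≡.refl → j≢i ≡.refl }))))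
            (+-identityˡ _)

    ∑-single : ∀ (w : A → ℝ) a → (∀ b → b ≢ a → w b ≈ 0#) → ∑ w ≈ w a
    ∑-single w a w≈0 = trans
      (sum-single (w ∘ from) (to a)
        (λ i i≢a → w≈0 (from i)
          (λ fi≡a → i≢a (≡.trans (≡.sym (Inverse.strictlyInverseˡ finite i)) (≡.cong to fi≡a)))))
      (reflexive (≡.cong w (Inverse.strictlyInverseʳ finite a)))

    ∑-zero⁻ : ∀ (w : A → ℝ) → (∀ a → 0# ≤ w a) → ∑ w ≈ 0# → ∀ a → w a ≈ 0#
    ∑-zero⁻ w 0≤w eq a = trans
      (reflexive (≡.cong w (≡.sym (Inverse.strictlyInverseʳ finite a))))
      (sum-zero⁻ (w ∘ from) (0≤w ∘ from) eq (to a))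

  ∑-cong : ∀ {v w : A → ℝ} → (∀ a → v a ≈ w a) → ∑ v ≈ ∑ w
  ∑-cong eq = sum-cong-≋ (eq ∘ from)

  ∑ⁿ-cong : ∀ {n} {v w : Vec A n → ℝ} → (∀ s → v s ≈ w s) → ∑ⁿ v ≈ ∑ⁿ w
  ∑ⁿ-cong {zero}  eq = eq []
  ∑ⁿ-cong {suc n} eq = ∑-cong (λ a → ∑ⁿ-cong (λ s → eq (a ∷ s)))

  ∑ⁿ-nonNeg : ∀ {n} {w : Vec A n → ℝ} → (∀ s → 0# ≤ w s) → 0# ≤ ∑ⁿ w
  ∑ⁿ-nonNeg {zero}  0≤w = 0≤w []
  ∑ⁿ-nonNeg {suc n} 0≤w = sum-nonNeg _ (λ i → ∑ⁿ-nonNeg (λ s → 0≤w (from i ∷ s)))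

  ∑ⁿ-zero : ∀ {n} {w : Vec A n → ℝ} → (∀ s → w s ≈ 0#) → ∑ⁿ w ≈ 0#
  ∑ⁿ-zero {zero}  w≈0 = w≈0 []
  ∑ⁿ-zero {suc n} w≈0 = sum-zero _ (λ i → ∑ⁿ-zero (λ s → w≈0 (from i ∷ s)))

  -- Nothing can cancel in a sum without negative terms. This is how an event of probability 0 is
  -- seen to miss the support.
  ∑ⁿ-zero⁻ : ∀ {n} {w : Vec A n → ℝ} → (∀ s → 0# ≤ w s) → ∑ⁿ w ≈ 0# → ∀ s → w s ≈ 0#
  ∑ⁿ-zero⁻ 0≤w eq []      = eq
  ∑ⁿ-zero⁻ 0≤w eq (a ∷ s) = ∑ⁿ-zero⁻ (0≤w ∘ (a ∷_))
    (∑-zero⁻ _ (λ b → ∑ⁿ-nonNeg (0≤w ∘ (b ∷_))) eq a) s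

  ∑ⁿ-single : ∀ {n} {w : Vec A n → ℝ} s → (∀ t → t ≢ s → w t ≈ 0#) → ∑ⁿ w ≈ w s
  ∑ⁿ-single []      w≈0 = refl
  ∑ⁿ-single (a ∷ s) w≈0 = trans
    (∑-single _ a (λ b b≢a → ∑ⁿ-zero (λ t → w≈0 (b ∷ t) (b≢a ∘ ≡.cong head))))
    (∑ⁿ-single s (λ t t≢s → w≈0 (a ∷ t) (t≢s ∘ Vec.∷-injectiveʳ)))

  ∑ⁿ-+ : ∀ {n} (v w : Vec A n → ℝ) → ∑ⁿ (λ s → v s + w s) ≈ ∑ⁿ v + ∑ⁿ w
  ∑ⁿ-+ {zero}  v w = refl
  ∑ⁿ-+ {suc n} v w = trans (∑-cong (λ a → ∑ⁿ-+ (v ∘ (a ∷_)) (w ∘ (a ∷_)))) (∑-distrib-+ {size} _ _)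

  ∑ⁿ-*ˡ : ∀ {n} x (w : Vec A n → ℝ) → ∑ⁿ (λ s → x * w s) ≈ x * ∑ⁿ w
  ∑ⁿ-*ˡ {zero}  x w = refl
  ∑ⁿ-*ˡ {suc n} x w =
    trans (∑-cong (λ a → ∑ⁿ-*ˡ x (w ∘ (a ∷_)))) (sym (*-distribˡ-sum {size} x _))

  ∑ⁿ-*ʳ : ∀ {n} (w : Vec A n → ℝ) x → ∑ⁿ (λ s → w s * x) ≈ ∑ⁿ w * x
  ∑ⁿ-*ʳ {n} w x = trans (∑ⁿ-cong {n} (λ s → *-comm _ _)) (trans (∑ⁿ-*ˡ x w) (*-comm _ _))

  private
    ∑-∑ⁿ-comm : ∀ {n} (w : A → Vec A n → ℝ) →
                ∑ (λ a → ∑ⁿ (w a)) ≈ ∑ⁿ (λ s → ∑ λ a → w a s)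
    ∑-∑ⁿ-comm {zero}  w = refl
    ∑-∑ⁿ-comm {suc n} w =
      trans (∑-comm {size} {size} _) (∑-cong (λ b → ∑-∑ⁿ-comm (λ a s → w a (b ∷ s))))

  ∑ⁿ-comm : ∀ {m n} (w : Vec A m → Vec A n → ℝ) →
            ∑ⁿ (λ s → ∑ⁿ (w s)) ≈ ∑ⁿ (λ t → ∑ⁿ λ s → w s t)
  ∑ⁿ-comm {zero}  w = refl
  ∑ⁿ-comm {suc m} w =
    trans (∑-cong (λ a → ∑ⁿ-comm (w ∘ (a ∷_)))) (∑-∑ⁿ-comm (λ a t → ∑ⁿ (λ s → w (a ∷ s) t)))

  ∑ⁿ-++ : ∀ r {n} (w : Vec A (r ℕ.+ n) → ℝ) →
          ∑ⁿ w ≈ ∑ⁿ {r} (λ as → ∑ⁿ {n} (λ s → w (as ++ s)))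
  ∑ⁿ-++ zero    w = refl
  ∑ⁿ-++ (suc r) w = ∑-cong (λ a → ∑ⁿ-++ r (w ∘ (a ∷_)))

-- The translation

-- A new block is placed before the old variables, just as `ex new` places a single variable; `back`
-- shifts the old variables accordingly.
front : ∀ r {n} → Vec (Fin (r ℕ.+ n)) r
front r = map (_↑ˡ _) (allFin r)

back : ∀ r {n k} → Vec (Fin n) k → Vec (Fin (r ℕ.+ n)) k
back r = map (r ↑ʳ_)

Blocks : List ℕ → ℕ → Set
Blocks Γ n = All (Vec (Fin n)) Γ

backs : ∀ r {Γ n} → Blocks Γ n → Blocks Γ (r ℕ.+ n)
backs r = All.map (back r)

module Translation (τ : Vocabulary) where

  open FO τ

  infixr 5 _⩒_

  -- Boolean disjunction, by De Morgan; the primitive `∨` splits the team instead.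
  _⩒_ : ∀ {n} → Formula n → Formula n → Formula n
  φ ⩒ ψ = ∼ (∼ φ ∧ ∼ ψ)

  -- For empty tuples, both sides of the independence equation are the same product.
  verum falsum : ∀ {n} → Formula n
  verum  = indep [] [] []
  falsum = ∼ verum

  -- Even when k = 0 or k = 1, the clause of ∨ requires that both
  -- disjuncts hold in some probabilistic team.
  flatOr : ∀ {n} → Formula n → Formula n → Formula n
  flatOr φ ψ = φ ⩒ ψ ⩒ φ ∨ ψ

  constant : ∀ {n k} → Vec (Fin n) k → Formula n
  constant xs = indep [] xs xs

  equal distinct : ∀ {n k} → Vec (Fin n) k → Vec (Fin n) k → Formula n
  equal []       []       = verum
  equal (x ∷ xs) (y ∷ ys) = rel equality (x ∷ y ∷ []) ∧ equal xs ys
  distinct []       []       = falsum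
  distinct (x ∷ xs) (y ∷ ys) = flatOr (¬rel equality (x ∷ y ∷ [])) (distinct xs ys)

  -- The two cases have to be decided separately for each assignment of the support, hence `flatOr`
  -- and not `⩒`.
  coincide : ∀ {n k} → Vec (Fin n) k → Vec (Fin n) k → Vec (Fin n) k → Formula n
  coincide xs ys zs = flatOr (equal xs zs ∧ equal ys zs) (distinct xs zs ∧ distinct ys zs)

  -- Peeling off the innermost quantifier first makes the numbers of variables match by computation.
  exBlock : ∀ r {n} → Formula (r ℕ.+ n) → Formula n
  exBlock zero    φ = φ
  exBlock (suc r) φ = exBlock r (ex new φ)

  -- If zs is constant with value c on the support of 𝕏, this says that
  -- ∣ 𝕏 [ xs ≔ c ]∣ and ∣ 𝕏 [ ys ≔ c ]∣ are equal.
  pointEqual : ∀ {n k} → Vec (Fin n) k → Vec (Fin n) k → Vec (Fin n) k → Formula n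
  pointEqual {k = k} xs ys zs =
    exBlock k (front k ≈ back k xs ∧ coincide (front k) (back k ys) (back k zs))

  -- The blocks of `g` and `h` may be correlated in the given team, so the product needs fresh
  -- copies that are independent. As the identity is claimed only at the values of `u` and `v`, the
  -- comparison is `pointEqual` and not `≈`, which would compare whole distributions. For a
  -- marginal, dropping the last coordinates of the block of `g` already performs the summation.
  identity : ∀ {Γ n N i j} → SO.Identity τ {Γ} {n} i j →
             Blocks Γ N → Vec (Fin N) n → Formula N
  identity {N = N} (SO.product {a} {b} f g h _ _ _ u v) β xs =
    exBlock b (exBlock a
      (gs ≈ All.lookup β′ g ∧ hs ≈ All.lookup β′ h ∧ indep [] gs hs ∧
       pointEqual (All.lookup β′ f) (gs ++ hs) (back a (back b xs) ⟦ u ++ v ⟧)))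
    where
    gs : Vec (Fin (a ℕ.+ (b ℕ.+ N))) a
    gs = front a
    hs : Vec (Fin (a ℕ.+ (b ℕ.+ N))) b
    hs = back a (front b)
    β′ = backs a (backs b β)
  identity (SO.marginal {a} f g _ u) β xs =
    pointEqual (All.lookup β f) (take a (All.lookup β g)) (xs ⟦ u ⟧)

  matrix : ∀ {Γ n N θ} → SO.Matrix τ {Γ} {n} θ → Blocks Γ N → Vec (Fin N) n → Formula N
  matrix (SO._==_ e)   β xs = identity e β xs
  matrix (SO._!=_ e)   β xs = ∼ identity e β xs
  matrix (SO.rel R ys)  β xs = rel R (xs ⟦ ys ⟧)
  matrix (SO.¬rel R ys) β xs = ¬rel R (xs ⟦ ys ⟧)
  matrix (θ SO.∧ χ)     β xs = matrix θ β xs ∧ matrix χ β xs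
  matrix (θ SO.∨ χ)     β xs = matrix θ β xs ⩒ matrix χ β xs

  universal : ∀ {Γ n N φ} → SO.Universal τ {Γ} {n} φ →
              Blocks Γ N → Vec (Fin N) n → Formula N
  universal (SO.matrix θ) β xs = matrix θ β xs
  universal (SO.all φ)    β xs = ∼ exBlock 1
    (constant (front 1) ∧ ∼ universal φ (backs 1 β) (front 1 ++ back 1 xs))

  prenex : ∀ {Γ N φ} → SO.Prenex τ {Γ} {0} φ → Blocks Γ N → Formula N
  prenex (SO.universal φ)    β = universal φ β []
  prenex (SO.exF {r = r} φ)  β = exBlock r (prenex φ (front r ∷ backs r β))
  prenex (SO.allF {r = r} φ) β = ∼ exBlock r (∼ prenex φ (front r ∷ backs r β))

-- Evaluation of tuples of variables under concatenated assignments

⟦⟧-++ : ∀ {A : Set} {n j k} (s : Assignment A n) (xs : Vec (Fin n) j) (ys : Vec (Fin n) k) →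
        s ⟦ xs ++ ys ⟧ ≡ s ⟦ xs ⟧ ++ s ⟦ ys ⟧
⟦⟧-++ s xs ys = Vec.map-++ (lookup s) xs ys

⟦⟧-front : ∀ {A : Set} {r n} (as : Vec A r) (s : Assignment A n) → (as ++ s) ⟦ front r ⟧ ≡ as
⟦⟧-front {r = r} as s = ≡.trans (≡.sym (Vec.map-∘ _ _ (allFin r)))
  (≡.trans (Vec.map-cong (Vec.lookup-++ˡ as s) (allFin r)) (Vec.map-lookup-allFin as))

⟦⟧-back : ∀ {A : Set} {r n k} (as : Vec A r) (s : Assignment A n) (xs : Vec (Fin n) k) →
          (as ++ s) ⟦ back r xs ⟧ ≡ s ⟦ xs ⟧
⟦⟧-back as s xs =
  ≡.trans (≡.sym (Vec.map-∘ _ _ xs)) (Vec.map-cong (Vec.lookup-++ʳ as s) xs)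

⟦⟧-front-back : ∀ {A : Set} {r n k} (as : Vec A r) (s : Assignment A n) (xs : Vec (Fin n) k) →
                (as ++ s) ⟦ front r ++ back r xs ⟧ ≡ as ++ s ⟦ xs ⟧
⟦⟧-front-back as s xs = ≡.trans (⟦⟧-++ (as ++ s) (front _) (back _ xs))
  (≡.cong₂ _++_ (⟦⟧-front as s) (⟦⟧-back as s xs))

⟦⟧-⟦⟧ : ∀ {A : Set} {n k r} (s : Assignment A n) (xs : Vec (Fin n) k) (ys : Vec (Fin k) r) →
        s ⟦ xs ⟦ ys ⟧ ⟧ ≡ (s ⟦ xs ⟧) ⟦ ys ⟧
⟦⟧-⟦⟧ s xs ys = ≡.trans (≡.sym (Vec.map-∘ _ _ ys))
  (Vec.map-cong (λ y → ≡.sym (Vec.lookup-map y (lookup s) xs)) ys)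

module Teams (em : ExcludedMiddle 0ℓ) (reals : RealNumbers)
             {τ : Vocabulary} (𝒜 : Structure τ) where

  open RealNumbers reals hiding (zero)
  open Order reals
  open Structure 𝒜 using (Equal) renaming (Universe to A)
  open Semantics reals 𝒜 renaming (_≟ⁿ_ to infix 4 _≟ⁿ_)
  open Sums reals 𝒜
  open Translation τ
  open SetoidReasoning setoid

  dne : {P : Set} → ¬ ¬ P → P
  dne = em⇒dne em

  -- Sums restricted to an event

  infix 5 _when_
  _when_ : {P : Set} → ℝ → Dec P → ℝ
  x when d = if does d then x else 0#

  when-yes : ∀ {P : Set} (d : Dec P) {x} → P → (x when d) ≈ x
  when-yes d p rewrite dec-true d p = refl

  when-no : ∀ {P : Set} (d : Dec P) {x} → ¬ P → (x when d) ≈ 0#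
  when-no d ¬p rewrite dec-false d ¬p = refl

  -- The conditions need to agree only where the weight is nonzero, so facts known just on the
  -- support of a team can be used inside sums.
  when-cong : ∀ {P Q : Set} (d : Dec P) (e : Dec Q) {x y} →
              x ≈ y → (¬ (x ≈ 0#) → P ⇔ Q) → (x when d) ≈ (y when e)
  when-cong d e {x} {y} x≈y P⇔Q with em {P = x ≈ 0#}
  ... | yes x≈0 = trans (zero-when d x≈0) (sym (zero-when e (trans (sym x≈y) x≈0)))
    where
    zero-when : ∀ {P : Set} (d : Dec P) {x} → x ≈ 0# → (x when d) ≈ 0#
    zero-when (yes _) x≈0 = x≈0
    zero-when (no _)  _   = refl
  ... | no x≉0 with d
  ...   | yes p = trans x≈y (sym (when-yes e (Equivalence.to (P⇔Q x≉0) p)))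
  ...   | no ¬p = sym (when-no e (¬p ∘ Equivalence.from (P⇔Q x≉0)))

  when-congˡ : ∀ {P : Set} (d : Dec P) {x y} → x ≈ y → (x when d) ≈ (y when d)
  when-congˡ d x≈y = when-cong d d x≈y (λ _ → mk⇔ (λ p → p) (λ p → p))

  when-nonNeg : ∀ {P : Set} (d : Dec P) {x} → 0# ≤ x → 0# ≤ (x when d)
  when-nonNeg (yes _) 0≤x = 0≤x
  when-nonNeg (no _)  _   = ≤-refl

  when-+ : ∀ {P : Set} (d : Dec P) x → (x when d) + (x when ¬? d) ≈ x
  when-+ (yes _) x = +-identityʳ x
  when-+ (no _)  x = +-identityˡ x

  *-when : ∀ {P : Set} (d : Dec P) {x y} → x * (y when d) ≈ (x * y when d)
  *-when (yes _) = refl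
  *-when (no _)  = zeroʳ _

  ∑ⁿ-when : ∀ {P : Set} (d : Dec P) {n} (w : Vec A n → ℝ) →
            ∑ⁿ (λ s → w s when d) ≈ (∑ⁿ w when d)
  ∑ⁿ-when (yes _) w = refl
  ∑ⁿ-when (no _) {n} w = ∑ⁿ-zero {n} (λ _ → refl)

  ∑ⁿ-δ : ∀ {n} (w : Vec A n → ℝ) c → ∑ⁿ (λ s → w s when (s ≟ⁿ c)) ≈ w c
  ∑ⁿ-δ w c = trans (∑ⁿ-single c (λ s s≢c → when-no (s ≟ⁿ c) s≢c)) (when-yes (c ≟ⁿ c) ≡.refl)

  ∑ⁿ-when-+ : ∀ {n} {P : Vec A n → Set} (P? : ∀ s → Dec (P s)) (w : Vec A n → ℝ) →
              ∑ⁿ (λ s → w s when P? s) + ∑ⁿ (λ s → w s when ¬? (P? s)) ≈ ∑ⁿ w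
  ∑ⁿ-when-+ {n} P? w = trans (sym (∑ⁿ-+ {n} _ _)) (∑ⁿ-cong {n} (λ s → when-+ (P? s) (w s)))

  ∑ⁿ-when-zero⁻ : ∀ {n} {P : Vec A n → Set} (P? : ∀ s → Dec (P s)) {w : Vec A n → ℝ} →
                  (∀ s → 0# ≤ w s) → ∑ⁿ (λ s → w s when P? s) ≈ 0# → ∀ s → P s → w s ≈ 0#
  ∑ⁿ-when-zero⁻ {n} P? 0≤w eq s p = trans (sym (when-yes (P? s) p))
    (∑ⁿ-zero⁻ {n} (λ t → when-nonNeg (P? t) (0≤w t)) eq s)

  normalise : ∀ {n} {w : Vec A n → ℝ} → (∀ s → 0# ≤ w s) → ¬ (∑ⁿ w ≈ 0#) →
              IsDistribution (λ s → w s * ∑ⁿ w ⁻¹)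
  normalise {n} {w} 0≤w ∑w≉0 =
    (λ s → *-nonNeg (0≤w s) (⁻¹-nonNeg (∑ⁿ-nonNeg {n} 0≤w) ∑w≉0)) ,
    trans (∑ⁿ-*ʳ w _) (*-inverseʳ ∑w≉0)

  -- Distributions of tuples in a team

  -- For `f = _⟦ xs ⟧` this unfolds to `∣ 𝕏 [ xs ≔ c ]∣`.
  mass : ∀ {n r} → Weights n → (Assignment A n → Vec A r) → Vec A r → ℝ
  mass 𝕏 f c = ∑ⁿ λ s → 𝕏 s when (f s ≟ⁿ c)

  mass-cong : ∀ {n r k} (𝕏 : Weights n)
              {f : Assignment A n → Vec A r} {g : Assignment A n → Vec A k} {c d} →
              (∀ s → s ∈supp 𝕏 → f s ≡ c ⇔ g s ≡ d) → mass 𝕏 f c ≈ mass 𝕏 g d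
  mass-cong {n} 𝕏 {f} {g} {c} {d} eq =
    ∑ⁿ-cong {n} (λ s → when-cong (f s ≟ⁿ c) (g s ≟ⁿ d) refl (eq s))

  mass-nonNeg : ∀ {n r} {𝕏 : Weights n} (f : Assignment A n → Vec A r) →
                (∀ s → 0# ≤ 𝕏 s) → ∀ c → 0# ≤ mass 𝕏 f c
  mass-nonNeg {n} f 0≤𝕏 c = ∑ⁿ-nonNeg {n} (λ s → when-nonNeg (f s ≟ⁿ c) (0≤𝕏 s))

  mass-one : ∀ {n r} {𝕏 : Weights n} {f : Assignment A n → Vec A r} {c} →
             ∑ⁿ 𝕏 ≈ 1# → (∀ s → s ∈supp 𝕏 → f s ≡ c) → mass 𝕏 f c ≈ 1#
  mass-one {n} {𝕏 = 𝕏} {f} {c} ∑𝕏≈1 eq = trans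
    (∑ⁿ-cong {n} (λ s → when-cong (f s ≟ⁿ c) (yes tt) refl
      (λ s∈ → mk⇔ (λ _ → tt) (λ _ → eq s s∈))))
    ∑𝕏≈1

  mass-zero : ∀ {n r} {𝕏 : Weights n} {f : Assignment A n → Vec A r} {c} →
              (∀ s → s ∈supp 𝕏 → f s ≢ c) → mass 𝕏 f c ≈ 0#
  mass-zero {n} {f = f} {c} neq = ∑ⁿ-zero {n} λ s →
    when-cong (f s ≟ⁿ c) (no ⊥-elim) refl (λ s∈ → mk⇔ (neq s s∈) ⊥-elim)

  ∑-mass : ∀ {n r} (𝕏 : Weights n) (f : Assignment A n → Vec A r) →
           ∑ⁿ (mass 𝕏 f) ≈ ∑ⁿ 𝕏
  ∑-mass {n} {r} 𝕏 f = begin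
    ∑ⁿ (λ c → ∑ⁿ λ s → 𝕏 s when (f s ≟ⁿ c))   ≈⟨ ∑ⁿ-comm {r} {n} _ ⟩
    ∑ⁿ (λ s → ∑ⁿ λ c → 𝕏 s when (f s ≟ⁿ c))   ≈⟨ ∑ⁿ-cong {n} (λ s → ∑ⁿ-single (f s)
                                                    (λ c c≢fs → when-no (f s ≟ⁿ c) (c≢fs ∘ ≡.sym))) ⟩
    ∑ⁿ (λ s → 𝕏 s when (f s ≟ⁿ f s))          ≈⟨ ∑ⁿ-cong {n} (λ s → when-yes (f s ≟ⁿ f s) ≡.refl) ⟩
    ∑ⁿ 𝕏                                      ∎

  -- An assignment `s` can contribute only to the summand with `d = s ⟦ ys ⟧`. This turns a `SUM`
  -- into the mass of a shorter tuple.
  ∑-mass-++ : ∀ {n a b} (𝕏 : Weights n) (xs : Vec (Fin n) a) (ys : Vec (Fin n) b) c →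
              mass 𝕏 (_⟦ xs ⟧) c ≈ ∑ⁿ λ d → mass 𝕏 (_⟦ xs ++ ys ⟧) (c ++ d)
  ∑-mass-++ {n} {a} {b} 𝕏 xs ys c = begin
    mass 𝕏 (_⟦ xs ⟧) c
      ≈⟨ ∑ⁿ-cong {n} (λ s → sum-over s) ⟨
    ∑ⁿ (λ s → ∑ⁿ {b} λ d → 𝕏 s when (s ⟦ xs ++ ys ⟧ ≟ⁿ c ++ d))
      ≈⟨ ∑ⁿ-comm {n} {b} _ ⟩
    ∑ⁿ (λ d → mass 𝕏 (_⟦ xs ++ ys ⟧) (c ++ d))
      ∎
    where
    sum-over : ∀ s → ∑ⁿ {b} (λ d → 𝕏 s when (s ⟦ xs ++ ys ⟧ ≟ⁿ c ++ d)) ≈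
                     (𝕏 s when (s ⟦ xs ⟧ ≟ⁿ c))
    sum-over s rewrite ⟦⟧-++ s xs ys = trans
      (∑ⁿ-single (s ⟦ ys ⟧) (λ d d≢ → when-no (_ ≟ⁿ c ++ d)
        (d≢ ∘ ≡.sym ∘ Vec.++-injectiveʳ (s ⟦ xs ⟧) c)))
      (when-cong (_ ≟ⁿ _) (_ ≟ⁿ c) refl
        (λ _ → mk⇔ (Vec.++-injectiveˡ (s ⟦ xs ⟧) c) (≡.cong (_++ s ⟦ ys ⟧))))

  support : ∀ {n} {𝕏 : Weights n} → ∑ⁿ 𝕏 ≈ 1# → ∃ λ s → s ∈supp 𝕏
  support {n} ∑𝕏≈1 = dne λ none → 0≉1
    (trans (sym (∑ⁿ-zero {n} (λ s → dne λ s∈ → none (s , s∈)))) ∑𝕏≈1)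

  mass-distribution : ∀ {n r} {𝕏 : Weights n} (f : Assignment A n → Vec A r) →
                      IsDistribution 𝕏 → IsDistribution (mass 𝕏 f)
  mass-distribution f (0≤𝕏 , ∑𝕏≈1) = mass-nonNeg f 0≤𝕏 , trans (∑-mass _ f) ∑𝕏≈1

  δ : ∀ {r} → Vec A r → Vec A r → ℝ
  δ c d = 1# when (d ≟ⁿ c)

  δ-distribution : ∀ {r} (c : Vec A r) → IsDistribution (δ c)
  δ-distribution c = (λ d → when-nonNeg (d ≟ⁿ c) 0≤1) , ∑ⁿ-δ (λ _ → 1#) c

  -- Joint distributions with a given marginal

  Marginal : ∀ r {n} → Weights (r ℕ.+ n) → Weights n → Set
  Marginal r 𝕐 𝕏 = ∀ s → ∑ⁿ {r} (λ as → 𝕐 (as ++ s)) ≈ 𝕏 s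

  module _ {r n} {𝕐 : Weights (r ℕ.+ n)} {𝕏 : Weights n} (marg : Marginal r 𝕐 𝕏) where

    ∑-marginal : ∑ⁿ 𝕐 ≈ ∑ⁿ 𝕏
    ∑-marginal = trans (∑ⁿ-++ r 𝕐) (trans (∑ⁿ-comm {r} {n} _) (∑ⁿ-cong {n} marg))

    -- After the sums are exchanged, the condition no longer involves the new block, which can
    -- therefore be summed out.
    mass-back : ∀ {k} (xs : Vec (Fin n) k) c →
                mass 𝕐 (_⟦ back r xs ⟧) c ≈ mass 𝕏 (_⟦ xs ⟧) c
    mass-back xs c = begin
      mass 𝕐 (_⟦ back r xs ⟧) c
        ≈⟨ ∑ⁿ-++ r {n} _ ⟩
      ∑ⁿ {r} (λ as → ∑ⁿ {n} λ s → 𝕐 (as ++ s) when ((as ++ s) ⟦ back r xs ⟧ ≟ⁿ c))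
        ≈⟨ ∑ⁿ-comm {r} {n} _ ⟩
      ∑ⁿ {n} (λ s → ∑ⁿ {r} λ as → 𝕐 (as ++ s) when ((as ++ s) ⟦ back r xs ⟧ ≟ⁿ c))
        ≈⟨ ∑ⁿ-cong {n} (λ s → ∑ⁿ-cong {r} λ as →
             reflexive (≡.cong (λ d → 𝕐 (as ++ s) when (d ≟ⁿ c)) (⟦⟧-back as s xs))) ⟩
      ∑ⁿ {n} (λ s → ∑ⁿ {r} λ as → 𝕐 (as ++ s) when (s ⟦ xs ⟧ ≟ⁿ c))
        ≈⟨ ∑ⁿ-cong {n} (λ s → ∑ⁿ-when (s ⟦ xs ⟧ ≟ⁿ c) {r} _) ⟩
      ∑ⁿ {n} (λ s → ∑ⁿ {r} (λ as → 𝕐 (as ++ s)) when (s ⟦ xs ⟧ ≟ⁿ c))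
        ≈⟨ ∑ⁿ-cong {n} (λ s → when-congˡ (s ⟦ xs ⟧ ≟ⁿ c) (marg s)) ⟩
      mass 𝕏 (_⟦ xs ⟧) c
        ∎

    marginal-supp : (∀ t → 0# ≤ 𝕐 t) → ∀ as s → (as ++ s) ∈supp 𝕐 → s ∈supp 𝕏
    marginal-supp 0≤𝕐 as s ∈𝕐 𝕏s≈0 =
      ∈𝕐 (∑ⁿ-zero⁻ {r} (λ bs → 0≤𝕐 (bs ++ s)) (trans (marg s) 𝕏s≈0) as)

  -- Extending a team by a probability kernel

  infixl 6 _⋉_
  -- An old assignment `s` is drawn from `𝕏`, then a new block from `G s`. The explicit witnesses
  -- for block quantifiers below have this form.
  _⋉_ : ∀ {n r} → Weights n → (Assignment A n → Vec A r → ℝ) → Weights (r ℕ.+ n)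
  _⋉_ {n} {r} 𝕏 G t = 𝕏 s * G s (t ⟦ front r ⟧)
    where s = t ⟦ back r (allFin n) ⟧

  module _ {n r} {𝕏 : Weights n} {G : Assignment A n → Vec A r → ℝ} where

    ⋉-++ : ∀ as s → (𝕏 ⋉ G) (as ++ s) ≈ 𝕏 s * G s as
    ⋉-++ as s rewrite ⟦⟧-back as s (allFin n) | Vec.map-lookup-allFin s | ⟦⟧-front as s = refl

    mass-⋉-front : ∀ as → mass (𝕏 ⋉ G) (_⟦ front r ⟧) as ≈ ∑ⁿ λ s → 𝕏 s * G s as
    mass-⋉-front as = begin
      mass (𝕏 ⋉ G) (_⟦ front r ⟧) as
        ≈⟨ ∑ⁿ-++ r {n} _ ⟩
      ∑ⁿ {r} (λ bs → ∑ⁿ {n} λ s → (𝕏 ⋉ G) (bs ++ s) when ((bs ++ s) ⟦ front r ⟧ ≟ⁿ as))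
        ≈⟨ ∑ⁿ-cong {r} (λ bs → ∑ⁿ-cong {n} λ s →
             trans (reflexive (≡.cong (λ d → (𝕏 ⋉ G) (bs ++ s) when (d ≟ⁿ as)) (⟦⟧-front bs s)))
                   (when-congˡ (bs ≟ⁿ as) (⋉-++ bs s))) ⟩
      ∑ⁿ {r} (λ bs → ∑ⁿ {n} λ s → 𝕏 s * G s bs when (bs ≟ⁿ as))
        ≈⟨ ∑ⁿ-cong {r} (λ bs → ∑ⁿ-when (bs ≟ⁿ as) {n} _) ⟩
      ∑ⁿ {r} (λ bs → ∑ⁿ {n} (λ s → 𝕏 s * G s bs) when (bs ≟ⁿ as))
        ≈⟨ ∑ⁿ-δ {r} _ as ⟩
      ∑ⁿ {n} (λ s → 𝕏 s * G s as)
        ∎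

    module _ (dist : ∀ s → IsDistribution (G s)) where

      ⋉-marginal : Marginal r (𝕏 ⋉ G) 𝕏
      ⋉-marginal s = begin
        ∑ⁿ {r} (λ as → (𝕏 ⋉ G) (as ++ s))   ≈⟨ ∑ⁿ-cong {r} (λ as → ⋉-++ as s) ⟩
        ∑ⁿ {r} (λ as → 𝕏 s * G s as)        ≈⟨ ∑ⁿ-*ˡ {r} (𝕏 s) (G s) ⟩
        𝕏 s * ∑ⁿ (G s)                      ≈⟨ *-congˡ (proj₂ (dist s)) ⟩
        𝕏 s * 1#                            ≈⟨ *-identityʳ (𝕏 s) ⟩
        𝕏 s                                 ∎

      ⋉-distribution : IsDistribution 𝕏 → IsDistribution (𝕏 ⋉ G)
      ⋉-distribution (0≤𝕏 , ∑𝕏≈1) =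
        (λ t → *-nonNeg (0≤𝕏 _) (proj₁ (dist _) _)) ,
        trans (∑-marginal {r} ⋉-marginal) ∑𝕏≈1

  module _ {n r} {𝕏 : Weights n} {g : Vec A r → ℝ} where

    mass-product-front : ∑ⁿ 𝕏 ≈ 1# → ∀ as → mass (𝕏 ⋉ λ _ → g) (_⟦ front r ⟧) as ≈ g as
    mass-product-front ∑𝕏≈1 as = begin
      mass (𝕏 ⋉ λ _ → g) (_⟦ front r ⟧) as   ≈⟨ mass-⋉-front {𝕏 = 𝕏} as ⟩
      ∑ⁿ {n} (λ s → 𝕏 s * g as)              ≈⟨ ∑ⁿ-*ʳ 𝕏 (g as) ⟩
      ∑ⁿ 𝕏 * g as                            ≈⟨ *-congʳ ∑𝕏≈1 ⟩
      1# * g as                              ≈⟨ *-identityˡ _ ⟩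
      g as                                   ∎

    -- A kernel that ignores the old assignment makes the new block independent of every old tuple.
    mass-product : ∀ {k} (xs : Vec (Fin n) k) as bs →
                   mass (𝕏 ⋉ λ _ → g) (_⟦ front r ++ back r xs ⟧) (as ++ bs) ≈
                   g as * mass 𝕏 (_⟦ xs ⟧) bs
    mass-product xs as bs = begin
      mass (𝕏 ⋉ λ _ → g) (_⟦ front r ++ back r xs ⟧) (as ++ bs)
        ≈⟨ ∑ⁿ-++ r {n} _ ⟩
      ∑ⁿ {r} (λ cs → ∑ⁿ {n} λ s →
        (𝕏 ⋉ λ _ → g) (cs ++ s) when ((cs ++ s) ⟦ front r ++ back r xs ⟧ ≟ⁿ as ++ bs))
        ≈⟨ ∑ⁿ-cong {r} (λ cs → ∑ⁿ-cong {n} λ s → split cs s) ⟩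
      ∑ⁿ {r} (λ cs → ∑ⁿ {n} λ s → g cs * (𝕏 s when (s ⟦ xs ⟧ ≟ⁿ bs)) when (cs ≟ⁿ as))
        ≈⟨ ∑ⁿ-cong {r} (λ cs → ∑ⁿ-when (cs ≟ⁿ as) {n} _) ⟩
      ∑ⁿ {r} (λ cs → ∑ⁿ {n} (λ s → g cs * (𝕏 s when (s ⟦ xs ⟧ ≟ⁿ bs))) when (cs ≟ⁿ as))
        ≈⟨ ∑ⁿ-δ {r} _ as ⟩
      ∑ⁿ {n} (λ s → g as * (𝕏 s when (s ⟦ xs ⟧ ≟ⁿ bs)))
        ≈⟨ ∑ⁿ-*ˡ {n} (g as) _ ⟩
      g as * mass 𝕏 (_⟦ xs ⟧) bs
        ∎
      where
      split : ∀ cs s →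
              ((𝕏 ⋉ λ _ → g) (cs ++ s) when ((cs ++ s) ⟦ front r ++ back r xs ⟧ ≟ⁿ as ++ bs)) ≈
              (g cs * (𝕏 s when (s ⟦ xs ⟧ ≟ⁿ bs)) when (cs ≟ⁿ as))
      split cs s with cs ≟ⁿ as
      ... | no cs≢as = when-no ((cs ++ s) ⟦ _ ⟧ ≟ⁿ as ++ bs)
        (λ eq → cs≢as (Vec.++-injectiveˡ cs as (≡.trans (≡.sym (⟦⟧-front-back cs s xs)) eq)))
      ... | yes ≡.refl = begin
        ((𝕏 ⋉ λ _ → g) (cs ++ s) when ((cs ++ s) ⟦ front r ++ back r xs ⟧ ≟ⁿ cs ++ bs))
          ≈⟨ when-cong ((cs ++ s) ⟦ _ ⟧ ≟ⁿ cs ++ bs) (s ⟦ xs ⟧ ≟ⁿ bs)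
               (trans (⋉-++ {𝕏 = 𝕏} {G = λ _ → g} cs s) (*-comm _ _))
               (λ _ → mk⇔ (λ eq → Vec.++-injectiveʳ cs cs (≡.trans (≡.sym (⟦⟧-front-back cs s xs)) eq))
                          (λ eq → ≡.trans (⟦⟧-front-back cs s xs) (≡.cong (cs ++_) eq))) ⟩
        (g cs * 𝕏 s when (s ⟦ xs ⟧ ≟ⁿ bs))
          ≈⟨ *-when (s ⟦ xs ⟧ ≟ⁿ bs) ⟨
        g cs * (𝕏 s when (s ⟦ xs ⟧ ≟ⁿ bs))
          ∎

  -- Satisfaction

  open FO τ using (Formula; rel; ¬rel; indep; ∼_; _∧_; _∨_; ex; all)

  ⟨/⟩-cong : ∀ {n m} {𝕏 𝕐 : Weights n} F (x : Binder n m) → (∀ s → 𝕏 s ≈ 𝕐 s) →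
             ∀ s → (𝕏 ⟨ F / x ⟩) s ≈ (𝕐 ⟨ F / x ⟩) s
  ⟨/⟩-cong {n} F x 𝕏≈𝕐 s = ∑ⁿ-cong {n} λ t →
    when-congˡ (t [ lookup s (bound x) / x ] ≟ⁿ s) (*-congʳ (𝕏≈𝕐 t))

  -- Needed because the teams produced by quantifiers agree with the intended ones only pointwise
  -- and up to `≈`.
  ⊨-cong : ∀ {n} (φ : Formula n) {𝕏 𝕐 : Weights n} → (∀ s → 𝕏 s ≈ 𝕐 s) → 𝕏 ⊨ φ → 𝕐 ⊨ φ
  ⊨-cong (rel R xs)  𝕏≈𝕐 h s s∈ = h s (s∈ ∘ trans (sym (𝕏≈𝕐 s)))
  ⊨-cong (¬rel R xs) 𝕏≈𝕐 h s s∈ = h s (s∈ ∘ trans (sym (𝕏≈𝕐 s)))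
  ⊨-cong {n} (indep x y z) {𝕏} {𝕐} 𝕏≈𝕐 h s = begin
    _ * _   ≈⟨ *-cong (eq (x ++ y)) (eq (x ++ z)) ⟨
    _ * _   ≈⟨ h s ⟩
    _ * _   ≈⟨ *-cong (eq (x ++ y ++ z)) (eq x) ⟩
    _ * _   ∎
    where
    eq : ∀ {r} (xs : Vec (Fin n) r) → ∣ 𝕏 [ xs ≔ s ⟦ xs ⟧ ]∣ ≈ ∣ 𝕐 [ xs ≔ s ⟦ xs ⟧ ]∣
    eq xs = ∑ⁿ-cong {n} λ t → when-congˡ (t ⟦ xs ⟧ ≟ⁿ s ⟦ xs ⟧) (𝕏≈𝕐 t)
  ⊨-cong {n} (xs FO.≈ ys) {𝕏} {𝕐} 𝕏≈𝕐 h as = begin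
    ∣ 𝕐 [ xs ≔ as ]∣   ≈⟨ ∑ⁿ-cong {n} (λ t → when-congˡ (t ⟦ xs ⟧ ≟ⁿ as) (𝕏≈𝕐 t)) ⟨
    ∣ 𝕏 [ xs ≔ as ]∣   ≈⟨ h as ⟩
    ∣ 𝕏 [ ys ≔ as ]∣   ≈⟨ ∑ⁿ-cong {n} (λ t → when-congˡ (t ⟦ ys ⟧ ≟ⁿ as) (𝕏≈𝕐 t)) ⟩
    ∣ 𝕐 [ ys ≔ as ]∣   ∎
  ⊨-cong (∼ φ)   𝕏≈𝕐 h       = h ∘ ⊨-cong φ (sym ∘ 𝕏≈𝕐)
  ⊨-cong (φ ∧ ψ) 𝕏≈𝕐 (h , i) = ⊨-cong φ 𝕏≈𝕐 h , ⊨-cong ψ 𝕏≈𝕐 i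
  ⊨-cong (φ ∨ ψ) 𝕏≈𝕐 (𝕐 , ℤ , k , d𝕐 , dℤ , 0≤k , k≤1 , eq , hi) =
    𝕐 , ℤ , k , d𝕐 , dℤ , 0≤k , k≤1 , (λ s → trans (eq s) (𝕏≈𝕐 s)) , hi
  ⊨-cong (ex x φ)  𝕏≈𝕐 (F , dF , h) = F , dF , ⊨-cong φ (⟨/⟩-cong F x 𝕏≈𝕐) h
  ⊨-cong (all x φ) 𝕏≈𝕐 h            = ⊨-cong φ (⟨/⟩-cong uniform x 𝕏≈𝕐) h

  -- Quantification of blocks as extension to a joint team

  infix 3 _⊨ᴱ_
  -- The kernel-free semantics of `exBlock`: the joint team is arbitrary except for its marginal on
  -- the old variables.
  _⊨ᴱ_ : ∀ {r n} → Weights n → Formula (r ℕ.+ n) → Set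
  _⊨ᴱ_ {r} {n} 𝕏 φ =
    Σ (Weights (r ℕ.+ n)) λ 𝕐 → IsDistribution 𝕐 × Marginal r 𝕐 𝕏 × (𝕐 ⊨ φ)

  -- Disintegration: `𝕏` and a kernel `F` determine a joint team with marginal `𝕏`, and conversely
  -- the conditional distributions of a joint team supply a kernel.
  ex-new⇔ : ∀ {n} {𝕏 : Weights n} (φ : Formula (suc n)) → IsDistribution 𝕏 →
            (𝕏 ⊨ ex new φ) ⇔ (_⊨ᴱ_ {1} 𝕏 φ)
  ex-new⇔ {n} {𝕏} φ (0≤𝕏 , ∑𝕏≈1) = mk⇔ to from
    where
    ⟨/new⟩ : ∀ F a s → (𝕏 ⟨ F / new ⟩) (a ∷ s) ≈ 𝕏 s * F s a
    ⟨/new⟩ F a s = trans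
      (∑ⁿ-single {n} s (λ t t≢s → when-no (a ∷ t ≟ⁿ a ∷ s) (t≢s ∘ Vec.∷-injectiveʳ)))
      (when-yes (a ∷ s ≟ⁿ a ∷ s) ≡.refl)

    to : 𝕏 ⊨ ex new φ → _⊨ᴱ_ {1} 𝕏 φ
    to (F , dF , h) = 𝕏 ⟨ F / new ⟩ , (nonNeg , trans (∑-marginal {1} {𝕐 = 𝕏 ⟨ F / new ⟩} marg) ∑𝕏≈1) , marg , h
      where
      nonNeg : ∀ t → 0# ≤ (𝕏 ⟨ F / new ⟩) t
      nonNeg t = ∑ⁿ-nonNeg {n} λ s →
        when-nonNeg (s [ _ / new ] ≟ⁿ t) (*-nonNeg (0≤𝕏 s) (proj₁ (dF s) _))
      marg : Marginal 1 (𝕏 ⟨ F / new ⟩) 𝕏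
      marg s = begin
        ∑ (λ a → (𝕏 ⟨ F / new ⟩) (a ∷ s))   ≈⟨ ∑-cong (λ a → ⟨/new⟩ F a s) ⟩
        ∑ (λ a → 𝕏 s * F s a)               ≈⟨ ∑ⁿ-*ˡ {1} (𝕏 s) (λ as → F s (head as)) ⟩
        𝕏 s * ∑ (F s)                       ≈⟨ *-congˡ (proj₂ (dF s)) ⟩
        𝕏 s * 1#                            ≈⟨ *-identityʳ (𝕏 s) ⟩
        𝕏 s                                 ∎

    from : _⊨ᴱ_ {1} 𝕏 φ → 𝕏 ⊨ ex new φ
    from (𝕐 , (0≤𝕐 , ∑𝕐≈1) , marg , h) =
      (λ s → F s em) , (λ s → dF s em) , ⊨-cong φ (λ { (a ∷ s) → sym (eq a s) }) h
      where
      -- F s is the conditional distribution; outside the support of 𝕏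
      -- any distribution will do.
      F : ∀ s → Dec (𝕏 s ≈ 0#) → A → ℝ
      F s (yes _) a = ∑ⁿ λ t → 𝕐 (a ∷ t)
      F s (no _)  a = 𝕐 (a ∷ s) * 𝕏 s ⁻¹

      dF : ∀ s d → IsDistributionᴬ (F s d)
      dF s (yes _) = (λ a → ∑ⁿ-nonNeg {n} (λ t → 0≤𝕐 (a ∷ t))) , ∑𝕐≈1
      dF s (no ≉0) = (λ a → *-nonNeg (0≤𝕐 (a ∷ s)) (⁻¹-nonNeg (0≤𝕏 s) ≉0)) , (begin
        ∑ (λ a → 𝕐 (a ∷ s) * 𝕏 s ⁻¹)   ≈⟨ ∑ⁿ-*ʳ {1} (λ as → 𝕐 (as ++ s)) (𝕏 s ⁻¹) ⟩
        ∑ (λ a → 𝕐 (a ∷ s)) * 𝕏 s ⁻¹   ≈⟨ *-congʳ (marg s) ⟩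
        𝕏 s * 𝕏 s ⁻¹                   ≈⟨ *-inverseʳ ≉0 ⟩
        1#                             ∎)

      𝕏*F≈𝕐 : ∀ a s d → 𝕏 s * F s d a ≈ 𝕐 (a ∷ s)
      𝕏*F≈𝕐 a s (no ≉0)  = cancel-÷ (𝕐 (a ∷ s)) ≉0
      -- Where `𝕏 s` is 0, the nonnegative weights `𝕐 (a ∷ s)` sum to 0 over `a` and so vanish too.
      𝕏*F≈𝕐 a s (yes ≈0) = begin
        𝕏 s * _       ≈⟨ *-congʳ ≈0 ⟩
        0# * _        ≈⟨ zeroˡ _ ⟩
        0#            ≈⟨ ∑ⁿ-zero⁻ {1} (λ as → 0≤𝕐 (as ++ s)) (trans (marg s) ≈0) (a ∷ []) ⟨
        𝕐 (a ∷ s)     ∎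

      eq : ∀ a s → (𝕏 ⟨ (λ s → F s em) / new ⟩) (a ∷ s) ≈ 𝕐 (a ∷ s)
      eq a s = trans (⟨/new⟩ (λ s → F s em) a s) (𝕏*F≈𝕐 a s em)

  -- Induction on the length of the block. Marginals compose, up to exchanging the sum over the
  -- newest variable with the sums over the rest of the block.
  exBlock⇔ : ∀ r {n} {𝕏 : Weights n} (φ : Formula (r ℕ.+ n)) → IsDistribution 𝕏 →
             (𝕏 ⊨ exBlock r φ) ⇔ (_⊨ᴱ_ {r} 𝕏 φ)
  exBlock⇔ zero {𝕏 = 𝕏} φ d = mk⇔
    (λ h → 𝕏 , d , (λ s → refl) , h)
    (λ { (𝕐 , _ , marg , h) → ⊨-cong φ marg h })
  exBlock⇔ (suc r) {n} {𝕏} φ d = mk⇔ to from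
    where
    to : 𝕏 ⊨ exBlock (suc r) φ → _⊨ᴱ_ {suc r} 𝕏 φ
    to h with 𝕐 , d𝕐 , marg𝕐 , h𝕐 ← Equivalence.to (exBlock⇔ r (ex new φ) d) h
         with ℤ , dℤ , margℤ , hℤ ← Equivalence.to (ex-new⇔ φ d𝕐) h𝕐 =
      ℤ , dℤ ,
      (λ s → trans (∑ⁿ-comm {1} {r} (λ a as → ℤ (a ++ as ++ s)))
                   (trans (∑ⁿ-cong {r} (λ as → margℤ (as ++ s))) (marg𝕐 s))) ,
      hℤ

    from : _⊨ᴱ_ {suc r} 𝕏 φ → 𝕏 ⊨ exBlock (suc r) φ
    from (ℤ , dℤ , margℤ , hℤ) = Equivalence.from (exBlock⇔ r (ex new φ) d)
      (𝕐 , d𝕐 , (λ s → trans (sym (∑ⁿ-comm {1} {r} (λ a as → ℤ (a ++ as ++ s)))) (margℤ s)) ,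
       Equivalence.from (ex-new⇔ φ d𝕐) (ℤ , dℤ , (λ s → refl) , hℤ))
      where
      𝕐 : Weights (r ℕ.+ n)
      -- The intermediate team arises from `ℤ` by summing out its newest variable.
      𝕐 t = ∑ λ a → ℤ (a ∷ t)
      d𝕐 : IsDistribution 𝕐
      d𝕐 = (λ t → ∑ⁿ-nonNeg {1} (λ as → proj₁ dℤ (as ++ t))) ,
           trans (sym (∑ⁿ-comm {1} {r ℕ.+ n} (λ as t → ℤ (as ++ t)))) (proj₂ dℤ)

  -- Boolean disjunction and flat formulas

  ⩒⇔ : ∀ {n} {𝕏 : Weights n} (φ ψ : Formula n) → (𝕏 ⊨ φ ⩒ ψ) ⇔ ((𝕏 ⊨ φ) ⊎ (𝕏 ⊨ ψ))
  ⩒⇔ φ ψ = mk⇔ (λ h → dne λ ¬⊎ → h (¬⊎ ∘ inj₁ , ¬⊎ ∘ inj₂))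
               (λ { (inj₁ h) (¬h , _) → ¬h h ; (inj₂ h) (_ , ¬h) → ¬h h })

  Equal⇔≡ : ∀ {a b} → Equal (a ∷ b ∷ []) ⇔ (a ≡ b)
  Equal⇔≡ = mk⇔ (λ { (Structure.equal _) → ≡.refl }) (λ { ≡.refl → Structure.equal _ })

  -- Flatness in the sense of team semantics: satisfaction is tested at each assignment of the
  -- support separately. Restricting to `IsDistribution` ensures that the support is never empty.
  record Flat {n} (φ : Formula n) (P : Assignment A n → Set) : Set where
    constructor mkFlat
    field on : ∀ {𝕏 : Weights n} → IsDistribution 𝕏 →
               (𝕏 ⊨ φ) ⇔ (∀ s → s ∈supp 𝕏 → P s)
  open Flat

  flat-⇔ : ∀ {n} {φ : Formula n} {P Q} → (∀ s → P s ⇔ Q s) → Flat φ P → Flat φ Q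
  flat-⇔ P⇔Q flat .on d = mk⇔
    (λ h s s∈ → Equivalence.to (P⇔Q s) (Equivalence.to (flat .on d) h s s∈))
    (λ h → Equivalence.from (flat .on d) (λ s s∈ → Equivalence.from (P⇔Q s) (h s s∈)))

  flat-rel : ∀ {n r} {R : Symbol τ r} {xs : Vec (Fin n) r} →
             Flat (rel R xs) (λ s → Structure.interpret 𝒜 R (s ⟦ xs ⟧))
  flat-rel .on _ = mk⇔ (λ h → h) (λ h → h)

  flat-¬rel : ∀ {n r} {R : Symbol τ r} {xs : Vec (Fin n) r} →
              Flat (¬rel R xs) (λ s → ¬ Structure.interpret 𝒜 R (s ⟦ xs ⟧))
  flat-¬rel .on _ = mk⇔ (λ h → h) (λ h → h)

  flat-∧ : ∀ {n} {φ ψ : Formula n} {P Q} → Flat φ P → Flat ψ Q → Flat (φ ∧ ψ) (λ s → P s × Q s)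
  flat-∧ flatφ flatψ .on d = mk⇔
    (λ (h , i) s s∈ → Equivalence.to (flatφ .on d) h s s∈ , Equivalence.to (flatψ .on d) i s s∈)
    (λ h → Equivalence.from (flatφ .on d) (λ s s∈ → proj₁ (h s s∈)) ,
           Equivalence.from (flatψ .on d) (λ s s∈ → proj₂ (h s s∈)))

  -- From right to left: if neither `P` nor `Q` holds throughout the support, the team is cut along
  -- `P` into two parts of positive weight, which are normalised and mixed again with these weights.
  -- Otherwise one disjunct holds alone, a case that `flatOr` includes.
  flat-or : ∀ {n} (φ ψ : Formula n) {P Q} → Flat φ P → Flat ψ Q →
            Flat (flatOr φ ψ) (λ s → P s ⊎ Q s)
  flat-or {n} φ ψ {P} {Q} flatφ flatψ .on {𝕏} d@(0≤𝕏 , ∑𝕏≈1) = mk⇔ to from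
    where
    to : 𝕏 ⊨ flatOr φ ψ → ∀ s → s ∈supp 𝕏 → P s ⊎ Q s
    to h s s∈ with Equivalence.to (⩒⇔ φ (ψ ⩒ φ ∨ ψ)) h
    ... | inj₁ hφ = inj₁ (Equivalence.to (flatφ .on d) hφ s s∈)
    ... | inj₂ h′ with Equivalence.to (⩒⇔ ψ (φ ∨ ψ)) h′
    ...   | inj₁ hψ = inj₂ (Equivalence.to (flatψ .on d) hψ s s∈)
    -- If both parts of the mixture gave `s` weight 0, so would `𝕏`.
    ...   | inj₂ (𝕐 , ℤ , k , d𝕐 , dℤ , _ , _ , eq , hφ , hψ) with em {P = 𝕐 s ≈ 0#}
    ...     | no 𝕐s≉0  = inj₁ (Equivalence.to (flatφ .on d𝕐) hφ s 𝕐s≉0)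
    ...     | yes 𝕐s≈0 = inj₂ (Equivalence.to (flatψ .on dℤ) hψ s λ ℤs≈0 → s∈ (begin
      𝕏 s                         ≈⟨ eq s ⟨
      k * 𝕐 s + (1# - k) * ℤ s    ≈⟨ +-cong (*-congˡ 𝕐s≈0) (*-congˡ ℤs≈0) ⟩
      k * 0# + (1# - k) * 0#      ≈⟨ +-cong (zeroʳ _) (zeroʳ _) ⟩
      0# + 0#                     ≈⟨ +-identityˡ 0# ⟩
      0#                          ∎))

    -- The proper split. Since `s` violates `P`, the part outside `P` has positive weight; since `t`
    -- violates `Q` and hence satisfies `P`, so has the part inside.
    module _ (h : ∀ s → s ∈supp 𝕏 → P s ⊎ Q s)
             {s} (s∈ : s ∈supp 𝕏) (¬Ps : ¬ P s)
             {t} (t∈ : t ∈supp 𝕏) (¬Qt : ¬ Q t) where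

      P? : ∀ s → Dec (P s)
      P? s = em
      𝕐 ℤ : Weights n
      𝕐 s = 𝕏 s when P? s
      ℤ s = 𝕏 s when ¬? (P? s)
      k l : ℝ
      k = ∑ⁿ 𝕐
      l = ∑ⁿ ℤ

      Pt : P t
      Pt with h t t∈
      ... | inj₁ p = p
      ... | inj₂ q = contradiction q ¬Qt

      0≤𝕐 : ∀ s → 0# ≤ 𝕐 s
      0≤𝕐 s = when-nonNeg (P? s) (0≤𝕏 s)
      0≤ℤ : ∀ s → 0# ≤ ℤ s
      0≤ℤ s = when-nonNeg (¬? (P? s)) (0≤𝕏 s)
      0≤l : 0# ≤ l
      0≤l = ∑ⁿ-nonNeg {n} 0≤ℤ
      k≉0 : ¬ (k ≈ 0#)
      k≉0 k≈0 = t∈ (∑ⁿ-when-zero⁻ P? 0≤𝕏 k≈0 t Pt)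
      l≉0 : ¬ (l ≈ 0#)
      l≉0 l≈0 = s∈ (∑ⁿ-when-zero⁻ (¬? ∘ P?) 0≤𝕏 l≈0 s ¬Ps)

      k+l≈1 : k + l ≈ 1#
      k+l≈1 = trans (∑ⁿ-when-+ P? 𝕏) ∑𝕏≈1

      mix≈𝕏 : ∀ s → mix k (λ s → 𝕐 s * k ⁻¹) (λ s → ℤ s * l ⁻¹) s ≈ 𝕏 s
      mix≈𝕏 s = begin
        k * (𝕐 s * k ⁻¹) + (1# - k) * (ℤ s * l ⁻¹)
          ≈⟨ +-congˡ (*-congʳ (x+y≈z⇒y≈z-x k+l≈1)) ⟨
        k * (𝕐 s * k ⁻¹) + l * (ℤ s * l ⁻¹)
          ≈⟨ +-cong (cancel-÷ (𝕐 s) k≉0) (cancel-÷ (ℤ s) l≉0) ⟩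
        𝕐 s + ℤ s
          ≈⟨ when-+ (P? s) (𝕏 s) ⟩
        𝕏 s
          ∎

      split : 𝕏 ⊨ φ ∨ ψ
      split =
        (λ s → 𝕐 s * k ⁻¹) , (λ s → ℤ s * l ⁻¹) , k , d𝕐 , dℤ ,
        ∑ⁿ-nonNeg {n} 0≤𝕐 , ≤-respʳ-≈ k+l≈1 (x≤x+y k 0≤l) , mix≈𝕏 ,
        Equivalence.from (flatφ .on d𝕐) hφ , Equivalence.from (flatψ .on dℤ) hψ
        where
        d𝕐 = normalise 0≤𝕐 k≉0
        dℤ = normalise 0≤ℤ l≉0
        hφ : ∀ s → s ∈supp (λ s → 𝕐 s * k ⁻¹) → P s
        hφ s s∈ = dne λ ¬p → s∈ (trans (*-congʳ (when-no (P? s) ¬p)) (zeroˡ _))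
        hψ : ∀ s → s ∈supp (λ s → ℤ s * l ⁻¹) → Q s
        hψ s s∈ with P? s
        ... | yes p = contradiction (zeroˡ _) s∈
        ... | no ¬p with h s (λ 𝕏s≈0 → s∈ (trans (*-congʳ 𝕏s≈0) (zeroˡ _)))
        ...   | inj₁ p = contradiction p ¬p
        ...   | inj₂ q = q

    from : (∀ s → s ∈supp 𝕏 → P s ⊎ Q s) → 𝕏 ⊨ flatOr φ ψ
    from h with em {P = ∃ λ s → (s ∈supp 𝕏) × (¬ P s)} | em {P = ∃ λ s → (s ∈supp 𝕏) × (¬ Q s)}
    ... | no ∀P | _ = Equivalence.from (⩒⇔ φ (ψ ⩒ φ ∨ ψ)) (inj₁
      (Equivalence.from (flatφ .on d) (λ s s∈ → dne λ ¬p → ∀P (s , s∈ , ¬p))))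
    ... | yes _ | no ∀Q = Equivalence.from (⩒⇔ φ (ψ ⩒ φ ∨ ψ)) (inj₂
      (Equivalence.from (⩒⇔ ψ (φ ∨ ψ)) (inj₁
        (Equivalence.from (flatψ .on d) (λ s s∈ → dne λ ¬q → ∀Q (s , s∈ , ¬q))))))
    ... | yes (s , s∈ , ¬p) | yes (t , t∈ , ¬q) = Equivalence.from (⩒⇔ φ (ψ ⩒ φ ∨ ψ)) (inj₂
      (Equivalence.from (⩒⇔ ψ (φ ∨ ψ)) (inj₂ (split h s∈ ¬p t∈ ¬q))))

  flat-equal : ∀ {n k} (xs ys : Vec (Fin n) k) → Flat (equal xs ys) (λ s → s ⟦ xs ⟧ ≡ s ⟦ ys ⟧)
  flat-equal []       []       .on d = mk⇔ (λ _ _ _ → ≡.refl) (λ _ _ → refl)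
  flat-equal (x ∷ xs) (y ∷ ys) = flat-⇔
    (λ s → mk⇔ (λ { (eq , eqs) → ≡.cong₂ _∷_ eq eqs }) Vec.∷-injective)
    (flat-∧ (flat-⇔ (λ s → Equal⇔≡) flat-rel) (flat-equal xs ys))

  flat-distinct : ∀ {n k} (xs ys : Vec (Fin n) k) →
                  Flat (distinct xs ys) (λ s → s ⟦ xs ⟧ ≢ s ⟦ ys ⟧)
  flat-distinct []       []       .on d = mk⇔
    (λ h → contradiction (λ _ → refl) h)
    -- Empty tuples are never distinct, so the pointwise condition fails as soon as the support has
    -- an element.
    (λ h _ → let s , s∈ = support (proj₂ d) in h s s∈ ≡.refl)
  flat-distinct (x ∷ xs) (y ∷ ys) = flat-⇔
    (λ s → mk⇔ (λ { (inj₁ ¬eq) → ¬eq ∘ Vec.∷-injectiveˡ ; (inj₂ ¬eqs) → ¬eqs ∘ Vec.∷-injectiveʳ })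
               (λ ¬≡ → dne λ ¬⊎ → ¬⊎ (inj₁ λ eq → ¬⊎ (inj₂ λ eqs → ¬≡ (≡.cong₂ _∷_ eq eqs)))))
    (flat-or (¬rel equality (x ∷ y ∷ [])) (distinct xs ys)
      (flat-⇔ (λ s → mk⇔ (λ ¬E → ¬E ∘ Equivalence.from Equal⇔≡) (λ ¬≡ → ¬≡ ∘ Equivalence.to Equal⇔≡))
              flat-¬rel)
      (flat-distinct xs ys))

  flat-coincide : ∀ {n k} (xs ys zs : Vec (Fin n) k) → Flat (coincide xs ys zs)
    (λ s → (s ⟦ xs ⟧ ≡ s ⟦ zs ⟧ × s ⟦ ys ⟧ ≡ s ⟦ zs ⟧) ⊎
           (s ⟦ xs ⟧ ≢ s ⟦ zs ⟧ × s ⟦ ys ⟧ ≢ s ⟦ zs ⟧))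
  flat-coincide xs ys zs = flat-or _ _
    (flat-∧ (flat-equal xs zs) (flat-equal ys zs))
    (flat-∧ (flat-distinct xs zs) (flat-distinct ys zs))

  -- Tuples that are constant on the support

  -- As the empty tuple has mass 1, self-independence says that the mass `m` of each value satisfies
  -- `m * m ≈ m`. A value attained on the support has nonzero mass, hence mass 1, and leaves no
  -- weight for others. Conversely, the masses of a constant tuple are 0 or 1.
  constant⇔ : ∀ {n k} {𝕏 : Weights n} (xs : Vec (Fin n) k) → IsDistribution 𝕏 →
              (𝕏 ⊨ constant xs) ⇔ (∃ λ c → ∀ s → s ∈supp 𝕏 → s ⟦ xs ⟧ ≡ c)
  constant⇔ {n} {𝕏 = 𝕏} xs (0≤𝕏 , ∑𝕏≈1) = mk⇔ to from
    where
    mass-diagonal : ∀ s → mass 𝕏 (_⟦ xs ++ xs ⟧) (s ⟦ xs ++ xs ⟧) ≈ mass 𝕏 (_⟦ xs ⟧) (s ⟦ xs ⟧)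
    mass-diagonal s rewrite ⟦⟧-++ s xs xs = mass-cong 𝕏 {_⟦ xs ++ xs ⟧} {_⟦ xs ⟧} λ t _ → mk⇔
      (λ eq → Vec.++-injectiveˡ (t ⟦ xs ⟧) (s ⟦ xs ⟧) (≡.trans (≡.sym (⟦⟧-++ t xs xs)) eq))
      (λ eq → ≡.trans (⟦⟧-++ t xs xs) (≡.cong₂ _++_ eq eq))

    mass-[] : mass 𝕏 (_⟦ [] ⟧) [] ≈ 1#
    mass-[] = mass-one {𝕏 = 𝕏} {f = _⟦ [] ⟧} ∑𝕏≈1 (λ _ _ → ≡.refl)

    to : 𝕏 ⊨ constant xs → ∃ λ c → ∀ s → s ∈supp 𝕏 → s ⟦ xs ⟧ ≡ c
    to h with s , s∈ ← support ∑𝕏≈1 = s ⟦ xs ⟧ , λ t t∈ → dne λ t≢ →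
      t∈ (∑ⁿ-when-zero⁻ (λ t → ¬? (t ⟦ xs ⟧ ≟ⁿ s ⟦ xs ⟧)) 0≤𝕏 rest≈0 t t≢)
      where
      m = mass 𝕏 (_⟦ xs ⟧) (s ⟦ xs ⟧)
      m*m≈m : m * m ≈ m
      m*m≈m = trans (h s) (trans (*-cong (mass-diagonal s) mass-[]) (*-identityʳ m))
      m≈1 : m ≈ 1#
      m≈1 = *-cancelˡ-1
        (λ m≈0 → s∈ (∑ⁿ-when-zero⁻ (λ t → t ⟦ xs ⟧ ≟ⁿ s ⟦ xs ⟧) 0≤𝕏 m≈0 s ≡.refl)) m*m≈m
      rest≈0 : ∑ⁿ (λ t → 𝕏 t when ¬? (t ⟦ xs ⟧ ≟ⁿ s ⟦ xs ⟧)) ≈ 0#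
      rest≈0 = +-cancelˡ-0 (trans (∑ⁿ-when-+ (λ t → t ⟦ xs ⟧ ≟ⁿ s ⟦ xs ⟧) 𝕏)
                                  (trans ∑𝕏≈1 (sym m≈1)))

    from : (∃ λ c → ∀ s → s ∈supp 𝕏 → s ⟦ xs ⟧ ≡ c) → 𝕏 ⊨ constant xs
    from (c , h) s = trans idempotent (sym (trans (*-cong (mass-diagonal s) mass-[]) (*-identityʳ _)))
      where
      m = mass 𝕏 (_⟦ xs ⟧) (s ⟦ xs ⟧)
      idempotent : m * m ≈ m
      idempotent with s ⟦ xs ⟧ ≟ⁿ c
      ... | yes eq = trans (*-congʳ (mass-one ∑𝕏≈1 (λ t t∈ → ≡.trans (h t t∈) (≡.sym eq)))) (*-identityˡ _)
      ... | no neq = trans (*-congʳ m≈0) (trans (zeroˡ _) (sym m≈0))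
        where
        m≈0 : m ≈ 0#
        m≈0 = mass-zero (λ t t∈ eq → neq (≡.trans (≡.sym eq) (h t t∈)))

  Constant : ∀ {n k} → Weights n → Vec (Fin n) k → Vec A k → Set
  Constant 𝕏 xs c = ∀ s → s ∈supp 𝕏 → s ⟦ xs ⟧ ≡ c

  constant-⟦⟧ : ∀ {n k r} {𝕏 : Weights n} {xs : Vec (Fin n) k} {c} (ys : Vec (Fin k) r) →
                Constant 𝕏 xs c → Constant 𝕏 (xs ⟦ ys ⟧) (c ⟦ ys ⟧)
  constant-⟦⟧ {xs = xs} ys const s s∈ =
    ≡.trans (⟦⟧-⟦⟧ s xs ys) (≡.cong (_⟦ ys ⟧) (const s s∈))

  constant-back : ∀ {r n k} {𝕐 : Weights (r ℕ.+ n)} {𝕏 : Weights n} {xs : Vec (Fin n) k} {c} →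
                  (∀ t → 0# ≤ 𝕐 t) → Marginal r 𝕐 𝕏 → Constant 𝕏 xs c → Constant 𝕐 (back r xs) c
  constant-back {r} {xs = xs} 0≤𝕐 marg const t t∈ with as , s , ≡.refl ← splitAt r t =
    ≡.trans (⟦⟧-back as s xs) (const s (marginal-supp marg 0≤𝕐 as s t∈))

  -- Comparing two probabilities at a constant value

  module _ {n k} {𝕏 : Weights n} (d : IsDistribution 𝕏)
           (xs ys zs : Vec (Fin n) k) {c} (const : Constant 𝕏 zs c) where

    private
      f : Vec A k → ℝ
      f = mass 𝕏 (_⟦ xs ⟧)

      f-distribution : IsDistribution f
      f-distribution = mass-distribution (_⟦ xs ⟧) d

      f≢ : Vec A k → ℝ
      f≢ b = f b when ¬? (b ≟ⁿ c)

      0≤f≢ : ∀ b → 0# ≤ f≢ b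
      0≤f≢ b = when-nonNeg (¬? (b ≟ⁿ c)) (proj₁ f-distribution b)

      K : ℝ
      K = ∑ⁿ f≢

      -- The distribution of `xs` given that its value is not `c`. If this event has probability 0,
      -- `f` is a default: it only ever enters with total weight `K`.
      conditional : Dec (K ≈ 0#) → Vec A k → ℝ
      conditional (yes _) b = f b
      conditional (no _)  b = f≢ b * K ⁻¹

      conditional-distribution : ∀ K? → IsDistribution (conditional K?)
      conditional-distribution (yes _)  = f-distribution
      conditional-distribution (no K≉0) = normalise 0≤f≢ K≉0

      K*conditional : ∀ K? b → K * conditional K? b ≈ f≢ b
      K*conditional (no K≉0)  b = cancel-÷ (f≢ b) K≉0
      K*conditional (yes K≈0) b =
        trans (*-congʳ K≈0) (trans (zeroˡ _) (sym (∑ⁿ-zero⁻ 0≤f≢ K≈0 b)))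

      conditional-supp : ∀ K? → ¬ (K ≈ 0#) → ∀ b → ¬ (conditional K? b ≈ 0#) → b ≢ c
      conditional-supp (yes K≈0) K≉0 b _ = contradiction K≈0 K≉0
      conditional-supp (no _) _ b ≉0 b≡c =
        ≉0 (trans (*-congʳ (when-no (¬? (b ≟ⁿ c)) (λ b≢c → b≢c b≡c))) (zeroˡ _))

      kernel : ∀ {P : Set} → Dec P → Vec A k → ℝ
      kernel (yes _) = δ c
      kernel (no _)  = conditional em

      G : Assignment A n → Vec A k → ℝ
      G s = kernel (s ⟦ ys ⟧ ≟ⁿ c)

      G-distribution : ∀ s → IsDistribution (G s)
      G-distribution s with s ⟦ ys ⟧ ≟ⁿ c
      ... | yes _ = δ-distribution c
      ... | no _  = conditional-distribution em

      module _ (f≈ : f c ≈ mass 𝕏 (_⟦ ys ⟧) c) where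

        -- Both sides are complements, within total mass 1, of two probabilities that are equal by
        -- `f≈`.
        rest≈K : ∑ⁿ (λ s → 𝕏 s when ¬? (s ⟦ ys ⟧ ≟ⁿ c)) ≈ K
        rest≈K = trans (x+y≈z⇒y≈z-x (∑ⁿ-when-+ (λ s → s ⟦ ys ⟧ ≟ⁿ c) 𝕏))
          (trans (+-cong (trans (proj₂ d) (sym (proj₂ f-distribution))) (-‿cong (sym f≈)))
                 (sym (x+y≈z⇒y≈z-x (trans (+-congʳ (sym (∑ⁿ-δ f c)))
                                          (∑ⁿ-when-+ (λ b → b ≟ⁿ c) f)))))

        f*δ : ∀ b → f c * δ c b ≈ (f b when (b ≟ⁿ c))
        f*δ b with b ≟ⁿ c
        ... | yes ≡.refl = *-identityʳ _
        ... | no _       = zeroʳ _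

        -- Law of total probability over the event that `ys` equals `c`: the event contributes `f c`
        -- at the point `c`, and its complement contributes `f` away from `c`.
        mass-front : ∀ b → mass (𝕏 ⋉ G) (_⟦ front k ⟧) b ≈ f b
        mass-front b = begin
          mass (𝕏 ⋉ G) (_⟦ front k ⟧) b
            ≈⟨ mass-⋉-front {𝕏 = 𝕏} {G = G} b ⟩
          ∑ⁿ {n} (λ s → 𝕏 s * G s b)
            ≈⟨ ∑ⁿ-cong {n} split ⟩
          ∑ⁿ {n} (λ s → (𝕏 s when (s ⟦ ys ⟧ ≟ⁿ c)) * δ c b +
                        (𝕏 s when ¬? (s ⟦ ys ⟧ ≟ⁿ c)) * conditional em b)
            ≈⟨ ∑ⁿ-+ {n} _ _ ⟩
          ∑ⁿ {n} (λ s → (𝕏 s when (s ⟦ ys ⟧ ≟ⁿ c)) * δ c b) +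
          ∑ⁿ {n} (λ s → (𝕏 s when ¬? (s ⟦ ys ⟧ ≟ⁿ c)) * conditional em b)
            ≈⟨ +-cong (∑ⁿ-*ʳ {n} _ _) (∑ⁿ-*ʳ {n} _ _) ⟩
          mass 𝕏 (_⟦ ys ⟧) c * δ c b +
          ∑ⁿ (λ s → 𝕏 s when ¬? (s ⟦ ys ⟧ ≟ⁿ c)) * conditional em b
            ≈⟨ +-cong (*-congʳ (sym f≈)) (*-congʳ rest≈K) ⟩
          f c * δ c b + K * conditional em b
            ≈⟨ +-cong (f*δ b) (K*conditional em b) ⟩
          (f b when (b ≟ⁿ c)) + (f b when ¬? (b ≟ⁿ c))
            ≈⟨ when-+ (b ≟ⁿ c) (f b) ⟩
          f b
            ∎
          where
          split : ∀ s → 𝕏 s * G s b ≈ (𝕏 s when (s ⟦ ys ⟧ ≟ⁿ c)) * δ c b +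
                                      (𝕏 s when ¬? (s ⟦ ys ⟧ ≟ⁿ c)) * conditional em b
          split s with s ⟦ ys ⟧ ≟ⁿ c
          ... | yes _ = sym (trans (+-congˡ (zeroˡ _)) (+-identityʳ _))
          ... | no _  = sym (trans (+-congʳ (zeroˡ _)) (+-identityˡ _))

        G-supp : ∀ s b → s ∈supp 𝕏 → ¬ (G s b ≈ 0#) →
                 (b ≡ c × s ⟦ ys ⟧ ≡ c) ⊎ (b ≢ c × s ⟦ ys ⟧ ≢ c)
        G-supp s b s∈ ≉0 with s ⟦ ys ⟧ ≟ⁿ c
        ... | yes eq = inj₁ (dne (λ b≢c → ≉0 (when-no (b ≟ⁿ c) b≢c)) , eq)
        ... | no neq = inj₂ (conditional-supp em K≉0 b ≉0 , neq)
          where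
          -- The assignment `s` itself lies in the complement, which thus has positive weight; the
          -- default in `conditional` is excluded.
          K≉0 : ¬ (K ≈ 0#)
          K≉0 K≈0 = s∈ (∑ⁿ-when-zero⁻ (λ s → ¬? (s ⟦ ys ⟧ ≟ⁿ c)) (proj₁ d)
                                      (trans rest≈K K≈0) s neq)

    -- A copy of `xs` that takes the value `c` exactly where `ys` does has the same mass at `c` as
    -- `ys`. Conversely, if the masses agree, the kernel `G` produces such a copy.
    pointEqual⇔ : (𝕏 ⊨ pointEqual xs ys zs) ⇔ (mass 𝕏 (_⟦ xs ⟧) c ≈ mass 𝕏 (_⟦ ys ⟧) c)
    pointEqual⇔ = mk⇔ to from
      where
      to : 𝕏 ⊨ pointEqual xs ys zs → mass 𝕏 (_⟦ xs ⟧) c ≈ mass 𝕏 (_⟦ ys ⟧) c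
      to h with 𝕐 , d𝕐 , marg , h≈ , hc ← Equivalence.to (exBlock⇔ k _ d) h = begin
        mass 𝕏 (_⟦ xs ⟧) c          ≈⟨ mass-back {k} marg xs c ⟨
        mass 𝕐 (_⟦ back k xs ⟧) c   ≈⟨ h≈ c ⟨
        mass 𝕐 (_⟦ front k ⟧) c     ≈⟨ mass-cong 𝕐 {_⟦ front k ⟧} {_⟦ back k ys ⟧} agree ⟩
        mass 𝕐 (_⟦ back k ys ⟧) c   ≈⟨ mass-back {k} marg ys c ⟩
        mass 𝕏 (_⟦ ys ⟧) c          ∎
        where
        agree : ∀ t → t ∈supp 𝕐 → (t ⟦ front k ⟧ ≡ c) ⇔ (t ⟦ back k ys ⟧ ≡ c)
        agree t t∈ rewrite ≡.sym (constant-back (proj₁ d𝕐) marg const t t∈)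
          with Equivalence.to (flat-coincide (front k) (back k ys) (back k zs) .on d𝕐) hc t t∈
        ... | inj₁ (p , q)   = mk⇔ (λ _ → q) (λ _ → p)
        ... | inj₂ (¬p , ¬q) = mk⇔ (λ p → contradiction p ¬p) (λ q → contradiction q ¬q)

      from : mass 𝕏 (_⟦ xs ⟧) c ≈ mass 𝕏 (_⟦ ys ⟧) c → 𝕏 ⊨ pointEqual xs ys zs
      from f≈ = Equivalence.from (exBlock⇔ k _ d)
        (𝕏 ⋉ G , d𝕐 , marg ,
         (λ b → trans (mass-front f≈ b) (sym (mass-back {k} marg xs b))) ,
         Equivalence.from (flat-coincide (front k) (back k ys) (back k zs) .on d𝕐) agree)
        where
        d𝕐 = ⋉-distribution {𝕏 = 𝕏} G-distribution d
        marg : Marginal k (𝕏 ⋉ G) 𝕏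
        marg = ⋉-marginal G-distribution
        Agree : Assignment A (k ℕ.+ n) → Set
        Agree t = (t ⟦ front k ⟧ ≡ t ⟦ back k zs ⟧ × t ⟦ back k ys ⟧ ≡ t ⟦ back k zs ⟧) ⊎
                  (t ⟦ front k ⟧ ≢ t ⟦ back k zs ⟧ × t ⟦ back k ys ⟧ ≢ t ⟦ back k zs ⟧)
        agree-++ : ∀ b s → s ⟦ zs ⟧ ≡ c →
                   (b ≡ c × s ⟦ ys ⟧ ≡ c) ⊎ (b ≢ c × s ⟦ ys ⟧ ≢ c) → Agree (b ++ s)
        agree-++ b s eq r
          rewrite ⟦⟧-back b s ys | ⟦⟧-back b s zs | ⟦⟧-front b s | eq = r
        agree : ∀ t → t ∈supp (𝕏 ⋉ G) → Agree t
        agree t t∈ with b , s , ≡.refl ← splitAt k t =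
          agree-++ b s (const s s∈) (G-supp f≈ s b s∈
            (λ G≈0 → t∈ (trans (⋉-++ {𝕏 = 𝕏} {G = G} b s) (trans (*-congˡ G≈0) (zeroʳ _)))))
          where
          s∈ : s ∈supp 𝕏
          s∈ = marginal-supp marg (proj₁ d𝕐) b s t∈

  -- Correctness of the translation

  -- Nothing is demanded of the correlation between blocks, so the property survives every extension
  -- of the team.
  record Represents {Γ n} (𝕏 : Weights n) (β : Blocks Γ n) (ρ : Functions Γ) : Set where
    field weight : ∀ {r} (f : r ∈ Γ) c → mass 𝕏 (_⟦ All.lookup β f ⟧) c ≈ All.lookup ρ f c
  open Represents

  -- Allows the interpretations of function variables to serve as kernels when blocks are copied.
  represents-distribution : ∀ {Γ n} {𝕏 : Weights n} {β : Blocks Γ n} {ρ} → IsDistribution 𝕏 →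
                            Represents 𝕏 β ρ → ∀ {r} (f : r ∈ Γ) → IsDistribution (All.lookup ρ f)
  represents-distribution {β = β} d rep {r} f
    with 0≤m , ∑m≈1 ← mass-distribution (_⟦ All.lookup β f ⟧) d =
    (λ c → ≤-respʳ-≈ (rep .weight f c) (0≤m c)) ,
    trans (sym (∑ⁿ-cong {r} (rep .weight f))) ∑m≈1

  represents-backs : ∀ {r Γ n} {𝕐 : Weights (r ℕ.+ n)} {𝕏 : Weights n} {β : Blocks Γ n} {ρ} →
                     Marginal r 𝕐 𝕏 → Represents 𝕏 β ρ → Represents 𝕐 (backs r β) ρ
  represents-backs {r} {β = β} marg rep .weight f c
    rewrite All.lookup-map {f = back r} β f = trans (mass-back {r} marg (All.lookup β f) c) (rep .weight f c)

  represents-∷ : ∀ {r Γ n} {𝕐 : Weights (r ℕ.+ n)} {β : Blocks Γ (r ℕ.+ n)} {ρ} {f : Vec A r → ℝ} →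
                 (∀ c → mass 𝕐 (_⟦ front r ⟧) c ≈ f c) → Represents 𝕐 β ρ →
                 Represents 𝕐 (front r ∷ β) (f ∷ ρ)
  represents-∷ eq rep .weight (here ≡.refl) = eq
  represents-∷ eq rep .weight (there g)     = rep .weight g

  ≈-⇔ : ∀ {x x′ y y′} → x ≈ x′ → y ≈ y′ → (x ≈ y) ⇔ (x′ ≈ y′)
  ≈-⇔ x≈x′ y≈y′ = mk⇔ (λ x≈y → trans (sym x≈x′) (trans x≈y y≈y′))
                      (λ x′≈y′ → trans x≈x′ (trans x′≈y′ (sym y≈y′)))

  ¬-⇔ : ∀ {P Q : Set} → P ⇔ Q → (¬ P) ⇔ (¬ Q)
  ¬-⇔ P⇔Q = mk⇔ (_∘ Equivalence.from P⇔Q) (_∘ Equivalence.to P⇔Q)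

  module _ {Γ} {n N : ℕ} {ρ : Functions Γ} {σ : Assignment A n} where

    identity⇔ : ∀ {i j} (e : SO.Identity τ i j) {𝕏 : Weights N} {β xs} →
                IsDistribution 𝕏 → Represents 𝕏 β ρ → Constant 𝕏 xs σ →
                (𝕏 ⊨ identity e β xs) ⇔ (value ρ σ i ≈ value ρ σ j)
    identity⇔ (SO.marginal {a} {b} f g _ u) {𝕏} {β} {xs} d rep const =
      ≈-⇔ (rep .weight f (σ ⟦ u ⟧)) mass≈SUM
      ⇔-∘ pointEqual⇔ d (All.lookup β f) (take a B) (xs ⟦ u ⟧) (constant-⟦⟧ u const)
      where
      B : Vec (Fin N) (a ℕ.+ b)
      B = All.lookup β g
      mass≈SUM : mass 𝕏 (_⟦ take a B ⟧) (σ ⟦ u ⟧) ≈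
                 ∑ⁿ {b} (λ bs → All.lookup ρ g ((bs ++ σ) ⟦ back b u ++ front b ⟧))
      mass≈SUM = begin
        mass 𝕏 (_⟦ take a B ⟧) (σ ⟦ u ⟧)
          ≈⟨ ∑-mass-++ 𝕏 (take a B) (drop a B) (σ ⟦ u ⟧) ⟩
        ∑ⁿ {b} (λ bs → mass 𝕏 (_⟦ take a B ++ drop a B ⟧) (σ ⟦ u ⟧ ++ bs))
          ≡⟨ ≡.cong (λ B → ∑ⁿ {b} λ bs → mass 𝕏 (_⟦ B ⟧) (σ ⟦ u ⟧ ++ bs)) (Vec.take++drop≡id a B) ⟩
        ∑ⁿ {b} (λ bs → mass 𝕏 (_⟦ B ⟧) (σ ⟦ u ⟧ ++ bs))
          ≈⟨ ∑ⁿ-cong {b} (λ bs → rep .weight g (σ ⟦ u ⟧ ++ bs)) ⟩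
        ∑ⁿ {b} (λ bs → All.lookup ρ g (σ ⟦ u ⟧ ++ bs))
          ≈⟨ ∑ⁿ-cong {b} (λ bs → reflexive (≡.cong (All.lookup ρ g)
               (≡.trans (⟦⟧-++ (bs ++ σ) (back b u) (front b))
                        (≡.cong₂ _++_ (⟦⟧-back bs σ u) (⟦⟧-front bs σ))))) ⟨
        ∑ⁿ {b} (λ bs → All.lookup ρ g ((bs ++ σ) ⟦ back b u ++ front b ⟧))
          ∎
    identity⇔ (SO.product {a} {b} f g h f≢g f≢h g≢h u v) {𝕏} {β} {xs} d rep const = mk⇔ to from
      where
      β′ : Blocks Γ (a ℕ.+ (b ℕ.+ N))
      β′ = backs a (backs b β)
      xs′ : Vec (Fin (a ℕ.+ (b ℕ.+ N))) n
      xs′ = back a (back b xs)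
      gs : Vec (Fin (a ℕ.+ (b ℕ.+ N))) a
      gs = front a
      hs : Vec (Fin (a ℕ.+ (b ℕ.+ N))) b
      hs = back a (front b)
      ρf = All.lookup ρ f
      ρg = All.lookup ρ g
      ρh = All.lookup ρ h

      pointEqual⇔identity : ∀ {𝕐} → IsDistribution 𝕐 → Represents 𝕐 β′ ρ → Constant 𝕐 xs′ σ →
        mass 𝕐 (_⟦ gs ++ hs ⟧) (σ ⟦ u ⟧ ++ σ ⟦ v ⟧) ≈ ρg (σ ⟦ u ⟧) * ρh (σ ⟦ v ⟧) →
        (𝕐 ⊨ pointEqual (All.lookup β′ f) (gs ++ hs) (xs′ ⟦ u ++ v ⟧)) ⇔
        (ρf (σ ⟦ u ++ v ⟧) ≈ ρg (σ ⟦ u ⟧) * ρh (σ ⟦ v ⟧))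
      pointEqual⇔identity {𝕐} d𝕐 rep𝕐 const𝕐 product =
        ≈-⇔ (rep𝕐 .weight f (σ ⟦ u ++ v ⟧))
            (trans (reflexive (≡.cong (mass 𝕐 (_⟦ gs ++ hs ⟧)) (⟦⟧-++ σ u v))) product)
        ⇔-∘ pointEqual⇔ d𝕐 (All.lookup β′ f) (gs ++ hs) (xs′ ⟦ u ++ v ⟧) (constant-⟦⟧ (u ++ v) const𝕐)

      to : 𝕏 ⊨ identity (SO.product f g h f≢g f≢h g≢h u v) β xs →
           ρf (σ ⟦ u ++ v ⟧) ≈ ρg (σ ⟦ u ⟧) * ρh (σ ⟦ v ⟧)
      to φ with 𝕏₁ , d₁ , marg₁ , φ₁ ← Equivalence.to (exBlock⇔ b _ d) φ
           with 𝕏₂ , d₂ , marg₂ , gs≈ , hs≈ , ind , pe ← Equivalence.to (exBlock⇔ a _ d₁) φ₁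
           with s , _ ← support (proj₂ d) =
        Equivalence.to (pointEqual⇔identity d₂ rep₂ const₂ product) pe
        where
        rep₂ : Represents 𝕏₂ β′ ρ
        rep₂ = represents-backs {a} marg₂ (represents-backs {b} marg₁ rep)
        const₂ : Constant 𝕏₂ xs′ σ
        const₂ = constant-back (proj₁ d₂) marg₂ (constant-back (proj₁ d₁) marg₁ const)
        t : Assignment A (a ℕ.+ (b ℕ.+ N))
        -- Independence may be used at any assignment, whether in the support or not. The two fresh
        -- blocks get the required values; `s` merely fills in the old variables.
        t = σ ⟦ u ⟧ ++ σ ⟦ v ⟧ ++ s
        t-gs : t ⟦ gs ⟧ ≡ σ ⟦ u ⟧
        t-gs = ⟦⟧-front (σ ⟦ u ⟧) (σ ⟦ v ⟧ ++ s)
        t-hs : t ⟦ hs ⟧ ≡ σ ⟦ v ⟧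
        t-hs = ≡.trans (⟦⟧-back (σ ⟦ u ⟧) (σ ⟦ v ⟧ ++ s) (front b)) (⟦⟧-front (σ ⟦ v ⟧) s)
        product : mass 𝕏₂ (_⟦ gs ++ hs ⟧) (σ ⟦ u ⟧ ++ σ ⟦ v ⟧) ≈ ρg (σ ⟦ u ⟧) * ρh (σ ⟦ v ⟧)
        product = begin
          mass 𝕏₂ (_⟦ gs ++ hs ⟧) (σ ⟦ u ⟧ ++ σ ⟦ v ⟧)
            ≡⟨ ≡.cong (mass 𝕏₂ (_⟦ gs ++ hs ⟧))
                 (≡.trans (⟦⟧-++ t gs hs) (≡.cong₂ _++_ t-gs t-hs)) ⟨
          mass 𝕏₂ (_⟦ gs ++ hs ⟧) (t ⟦ gs ++ hs ⟧)
            ≈⟨ *-identityʳ _ ⟨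
          mass 𝕏₂ (_⟦ gs ++ hs ⟧) (t ⟦ gs ++ hs ⟧) * 1#
            -- The conditioning tuple is empty and has mass 1, so the conditional form of
            -- independence reduces to the product rule.
            ≈⟨ *-congˡ (mass-one {𝕏 = 𝕏₂} {f = _⟦ [] ⟧} (proj₂ d₂) (λ _ _ → ≡.refl)) ⟨
          mass 𝕏₂ (_⟦ gs ++ hs ⟧) (t ⟦ gs ++ hs ⟧) * mass 𝕏₂ (_⟦ [] ⟧) []
            ≈⟨ ind t ⟨
          mass 𝕏₂ (_⟦ gs ⟧) (t ⟦ gs ⟧) * mass 𝕏₂ (_⟦ hs ⟧) (t ⟦ hs ⟧)
            ≡⟨ ≡.cong₂ (λ x y → mass 𝕏₂ (_⟦ gs ⟧) x * mass 𝕏₂ (_⟦ hs ⟧) y) t-gs t-hs ⟩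
          mass 𝕏₂ (_⟦ gs ⟧) (σ ⟦ u ⟧) * mass 𝕏₂ (_⟦ hs ⟧) (σ ⟦ v ⟧)
            ≈⟨ *-cong (trans (gs≈ (σ ⟦ u ⟧)) (rep₂ .weight g (σ ⟦ u ⟧)))
                      (trans (hs≈ (σ ⟦ v ⟧)) (rep₂ .weight h (σ ⟦ v ⟧))) ⟩
          ρg (σ ⟦ u ⟧) * ρh (σ ⟦ v ⟧)
            ∎

      from : ρf (σ ⟦ u ++ v ⟧) ≈ ρg (σ ⟦ u ⟧) * ρh (σ ⟦ v ⟧) →
             𝕏 ⊨ identity (SO.product f g h f≢g f≢h g≢h u v) β xs
      from eq = Equivalence.from (exBlock⇔ b _ d) (𝕏₁ , d₁ , marg₁ ,
                Equivalence.from (exBlock⇔ a _ d₁) (𝕏₂ , d₂ , marg₂ ,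
                (λ c → trans (mass-gs c) (sym (rep₂ .weight g c))) ,
                (λ c → trans (mass-hs c) (sym (rep₂ .weight h c))) ,
                independent ,
                Equivalence.from (pointEqual⇔identity d₂ rep₂ const₂ (mass-gs-hs _ _)) eq))
        where
        𝕏₁ : Weights (b ℕ.+ N)
        -- The copies of `h` and then `g` are drawn independently of each other and of all old
        -- variables.
        𝕏₁ = 𝕏 ⋉ λ _ → ρh
        d₁ : IsDistribution 𝕏₁
        d₁ = ⋉-distribution {𝕏 = 𝕏} (λ _ → represents-distribution d rep h) d
        marg₁ : Marginal b 𝕏₁ 𝕏
        marg₁ = ⋉-marginal {𝕏 = 𝕏} (λ _ → represents-distribution d rep h)
        𝕏₂ : Weights (a ℕ.+ (b ℕ.+ N))
        𝕏₂ = 𝕏₁ ⋉ λ _ → ρg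
        d₂ : IsDistribution 𝕏₂
        d₂ = ⋉-distribution {𝕏 = 𝕏₁} (λ _ → represents-distribution d rep g) d₁
        marg₂ : Marginal a 𝕏₂ 𝕏₁
        marg₂ = ⋉-marginal {𝕏 = 𝕏₁} (λ _ → represents-distribution d rep g)
        rep₂ : Represents 𝕏₂ β′ ρ
        rep₂ = represents-backs {a} marg₂ (represents-backs {b} marg₁ rep)
        const₂ : Constant 𝕏₂ xs′ σ
        const₂ = constant-back (proj₁ d₂) marg₂ (constant-back (proj₁ d₁) marg₁ const)
        mass-gs : ∀ c → mass 𝕏₂ (_⟦ gs ⟧) c ≈ ρg c
        mass-gs = mass-product-front {𝕏 = 𝕏₁} {g = ρg} (proj₂ d₁)
        mass-front : ∀ c → mass 𝕏₁ (_⟦ front b ⟧) c ≈ ρh c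
        mass-front = mass-product-front {𝕏 = 𝕏} {g = ρh} (proj₂ d)
        mass-hs : ∀ c → mass 𝕏₂ (_⟦ hs ⟧) c ≈ ρh c
        mass-hs c = trans (mass-back {a} marg₂ (front b) c) (mass-front c)
        mass-gs-hs : ∀ c c′ → mass 𝕏₂ (_⟦ gs ++ hs ⟧) (c ++ c′) ≈ ρg c * ρh c′
        mass-gs-hs c c′ = trans (mass-product {𝕏 = 𝕏₁} {g = ρg} (front b) c c′)
                                (*-congˡ (mass-front c′))
        independent : 𝕏₂ ⊨ indep [] gs hs
        independent t = begin
          mass 𝕏₂ (_⟦ gs ⟧) (t ⟦ gs ⟧) * mass 𝕏₂ (_⟦ hs ⟧) (t ⟦ hs ⟧)
            ≈⟨ *-cong (mass-gs (t ⟦ gs ⟧)) (mass-hs (t ⟦ hs ⟧)) ⟩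
          ρg (t ⟦ gs ⟧) * ρh (t ⟦ hs ⟧)
            ≈⟨ mass-gs-hs (t ⟦ gs ⟧) (t ⟦ hs ⟧) ⟨
          mass 𝕏₂ (_⟦ gs ++ hs ⟧) (t ⟦ gs ⟧ ++ t ⟦ hs ⟧)
            ≡⟨ ≡.cong (mass 𝕏₂ (_⟦ gs ++ hs ⟧)) (⟦⟧-++ t gs hs) ⟨
          mass 𝕏₂ (_⟦ gs ++ hs ⟧) (t ⟦ gs ++ hs ⟧)
            ≈⟨ *-identityʳ _ ⟨
          mass 𝕏₂ (_⟦ gs ++ hs ⟧) (t ⟦ gs ++ hs ⟧) * 1#
            ≈⟨ *-congˡ (mass-one {𝕏 = 𝕏₂} {f = _⟦ [] ⟧} (proj₂ d₂) (λ _ _ → ≡.refl)) ⟨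
          mass 𝕏₂ (_⟦ gs ++ hs ⟧) (t ⟦ gs ++ hs ⟧) * mass 𝕏₂ (_⟦ [] ⟧) []
            ∎

    -- Since `xs` is constant with value `σ`, the team evaluates the matrix at one point only; this
    -- is why `∼` and `⩒` render negated identities and disjunctions correctly.
    matrix⇔ : ∀ {θ} (m : SO.Matrix τ θ) {𝕏 : Weights N} {β xs} →
              IsDistribution 𝕏 → Represents 𝕏 β ρ → Constant 𝕏 xs σ →
              (𝕏 ⊨ matrix m β xs) ⇔ (ρ , σ ⊩ θ)
    matrix⇔ (SO._==_ e) d rep const = identity⇔ e d rep const
    matrix⇔ (SO._!=_ e) d rep const = ¬-⇔ (identity⇔ e d rep const)
    matrix⇔ (SO.rel R ys) d rep const = mk⇔
      -- Any assignment of the nonempty support transfers the literal to the point `σ`.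
      (λ h → let s , s∈ = support (proj₂ d) in
             ≡.subst interpretR (constant-⟦⟧ ys const s s∈) (h s s∈))
      (λ h s s∈ → ≡.subst interpretR (≡.sym (constant-⟦⟧ ys const s s∈)) h)
      where interpretR = Structure.interpret 𝒜 R
    matrix⇔ (SO.¬rel R ys) d rep const = mk⇔
      (λ h → let s , s∈ = support (proj₂ d) in
             ≡.subst ¬interpretR (constant-⟦⟧ ys const s s∈) (h s s∈))
      (λ h s s∈ → ≡.subst ¬interpretR (≡.sym (constant-⟦⟧ ys const s s∈)) h)
      where ¬interpretR = λ as → ¬ Structure.interpret 𝒜 R as
    matrix⇔ (l SO.∧ m) d rep const = matrix⇔ l d rep const ×-⇔ matrix⇔ m d rep const
    matrix⇔ (l SO.∨ m) d rep const =
      (matrix⇔ l d rep const ⊎-⇔ matrix⇔ m d rep const) ⇔-∘ ⩒⇔ (matrix l _ _) (matrix m _ _)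

  -- A counterexample `a` to the universal statement corresponds to an extension by one variable
  -- that is constantly `a`.
  universal⇔ : ∀ {Γ n N φ} (Φ : SO.Universal τ φ) {ρ : Functions Γ} {σ : Assignment A n}
               {𝕏 : Weights N} {β xs} →
               IsDistribution 𝕏 → Represents 𝕏 β ρ → Constant 𝕏 xs σ →
               (𝕏 ⊨ universal Φ β xs) ⇔ (ρ , σ ⊩ φ)
  universal⇔ (SO.matrix m) d rep const = matrix⇔ m d rep const
  universal⇔ {N = N} (SO.all {φ} Φ) {ρ} {σ} {𝕏} {β} {xs} d rep const = mk⇔ to from
    where
    instanceFails : Formula (suc N)
    instanceFails = constant (front 1) ∧ ∼ universal Φ (backs 1 β) (front 1 ++ back 1 xs)

    constant-∷ : ∀ {𝕐 : Weights (suc N)} {a} → IsDistribution 𝕐 → Marginal 1 𝕐 𝕏 →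
                 Constant 𝕐 (front 1) (a ∷ []) → Constant 𝕐 (front 1 ++ back 1 xs) (a ∷ σ)
    constant-∷ d𝕐 marg const₁ t t∈ = ≡.trans (⟦⟧-++ t (front 1) (back 1 xs))
      (≡.cong₂ _++_ (const₁ t t∈) (constant-back (proj₁ d𝕐) marg const t t∈))

    to : 𝕏 ⊨ universal (SO.all Φ) β xs → ∀ a → ρ , a ∷ σ ⊩ φ
    to h a = dne λ ¬φ → h (Equivalence.from (exBlock⇔ 1 instanceFails d)
      (𝕐 , d𝕐 , marg , Equivalence.from (constant⇔ (front 1) d𝕐) (_ , const₁) ,
       ¬φ ∘ Equivalence.to (universal⇔ Φ d𝕐 (represents-backs {1} marg rep)
                             (constant-∷ d𝕐 marg const₁))))
      where
      𝕐 : Weights (suc N)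
      -- The new variable takes the value `a` with probability 1.
      𝕐 = 𝕏 ⋉ λ _ → δ (a ∷ [])
      d𝕐 : IsDistribution 𝕐
      d𝕐 = ⋉-distribution {𝕏 = 𝕏} (λ _ → δ-distribution (a ∷ [])) d
      marg : Marginal 1 𝕐 𝕏
      marg = ⋉-marginal {𝕏 = 𝕏} (λ _ → δ-distribution (a ∷ []))
      const₁ : Constant 𝕐 (front 1) (a ∷ [])
      const₁ t t∈ = dne λ neq →
        t∈ (trans (*-congˡ (when-no (t ⟦ front 1 ⟧ ≟ⁿ a ∷ []) neq)) (zeroʳ _))

    from : (∀ a → ρ , a ∷ σ ⊩ φ) → 𝕏 ⊨ universal (SO.all Φ) β xs
    from h h∃ with 𝕐 , d𝕐 , marg , hc , ¬Φ ← Equivalence.to (exBlock⇔ 1 instanceFails d) h∃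
              with a ∷ [] , const₁ ← Equivalence.to (constant⇔ (front 1) d𝕐) hc =
      ¬Φ (Equivalence.from (universal⇔ Φ d𝕐 (represents-backs {1} marg rep)
                             (constant-∷ d𝕐 marg const₁)) (h a))

  -- The induction runs over arbitrary teams that represent `ρ`, because a quantified block may be
  -- correlated with the older ones in any way. The case of `allF` treats counterexamples as `exF`
  -- treats witnesses.
  prenex⇔ : ∀ {Γ N φ} (Φ : SO.Prenex τ φ) {ρ : Functions Γ} {𝕏 : Weights N} {β} →
            IsDistribution 𝕏 → Represents 𝕏 β ρ → (𝕏 ⊨ prenex Φ β) ⇔ (ρ , [] ⊩ φ)
  prenex⇔ (SO.universal Φ) d rep = universal⇔ Φ d rep (λ _ _ → ≡.refl)
  prenex⇔ {N = N} (SO.exF {r} {φ} Φ) {ρ} {𝕏} {β} d rep = mk⇔ to from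
    where
    to : 𝕏 ⊨ prenex (SO.exF Φ) β → ρ , [] ⊩ SO.exF r φ
    to h with 𝕐 , d𝕐 , marg , hΦ ← Equivalence.to (exBlock⇔ r _ d) h =
      -- The witness is the distribution of the new block, whatever its correlation with the rest.
      mass 𝕐 (_⟦ front r ⟧) , mass-distribution (_⟦ front r ⟧) d𝕐 ,
      Equivalence.to (prenex⇔ Φ d𝕐 (represents-∷ (λ _ → refl) (represents-backs {r} marg rep))) hΦ

    from : ρ , [] ⊩ SO.exF r φ → 𝕏 ⊨ prenex (SO.exF Φ) β
    -- A given `f` is realised by a block independent of all old variables.
    from (f , df , h) = Equivalence.from (exBlock⇔ r _ d) (𝕏 ⋉ (λ _ → f) , d𝕐 , marg ,
      Equivalence.from (prenex⇔ Φ d𝕐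
        (represents-∷ (mass-product-front {𝕏 = 𝕏} (proj₂ d)) (represents-backs {r} marg rep))) h)
      where
      d𝕐 = ⋉-distribution {𝕏 = 𝕏} (λ _ → df) d
      marg = ⋉-marginal {𝕏 = 𝕏} (λ _ → df)
  prenex⇔ {N = N} (SO.allF {r} {φ} Φ) {ρ} {𝕏} {β} d rep = mk⇔ to from
    where
    to : 𝕏 ⊨ prenex (SO.allF Φ) β → ρ , [] ⊩ SO.allF r φ
    to h f df = dne λ ¬φ → h (Equivalence.from (exBlock⇔ r _ d) (𝕏 ⋉ (λ _ → f) , d𝕐 , marg ,
      ¬φ ∘ Equivalence.to (prenex⇔ Φ d𝕐
        (represents-∷ (mass-product-front {𝕏 = 𝕏} (proj₂ d)) (represents-backs {r} marg rep)))))
      where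
      d𝕐 = ⋉-distribution {𝕏 = 𝕏} (λ _ → df) d
      marg = ⋉-marginal {𝕏 = 𝕏} (λ _ → df)

    from : ρ , [] ⊩ SO.allF r φ → 𝕏 ⊨ prenex (SO.allF Φ) β
    from h h∃ with 𝕐 , d𝕐 , marg , ¬Φ ← Equivalence.to (exBlock⇔ r _ d) h∃ =
      ¬Φ (Equivalence.from
        (prenex⇔ Φ d𝕐 (represents-∷ (λ _ → refl) (represents-backs {r} marg rep)))
        (h (mass 𝕐 (_⟦ front r ⟧)) (mass-distribution (_⟦ front r ⟧) d𝕐)))

  -- The initial team, whose only block represents `p`

  team-distribution : ∀ {k} {p : Vec A k → ℝ} → IsDistribution p → IsDistribution (team p)
  team-distribution {k} {p} (0≤p , ∑p≈1) = (λ s → 0≤p _) ,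
    trans (∑ⁿ-cong {k} (λ s → reflexive (≡.cong p (Vec.map-lookup-allFin s)))) ∑p≈1

  team-represents : ∀ {k} (p : Vec A k → ℝ) → Represents (team p) (allFin k ∷ []) (p ∷ [])
  team-represents {k} p .weight (here ≡.refl) c = begin
    ∑ⁿ (λ s → team p s when (s ⟦ allFin k ⟧ ≟ⁿ c))
      ≈⟨ ∑ⁿ-cong {k} (λ s → reflexive
           (≡.cong (λ t → p t when (t ≟ⁿ c)) (Vec.map-lookup-allFin s))) ⟩
    ∑ⁿ (λ s → p s when (s ≟ⁿ c))
      ≈⟨ ∑ⁿ-δ p c ⟩
    p c
      ∎

mainTheorem6 : ExcludedMiddle 0ℓ → (reals : RealNumbers) →
    (τ : Vocabulary) (k : ℕ)
    (φ : SO.Formula τ (k ∷ []) 0) → SO.Prenex τ φ →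
    Σ (FO.Formula τ k) λ Φ →
    (𝒜 : Structure τ) → let open Semantics reals 𝒜 in
    (p : Vec (Structure.Universe 𝒜) k → RealNumbers.ℝ reals) → IsDistribution p →
    (team p ⊨ Φ) ⇔ (p ∷ [] , [] ⊩ φ)
mainTheorem6 em reals τ k φ Φ = Translation.prenex τ Φ (allFin k ∷ []) , λ 𝒜 p d →
  let open Teams em reals 𝒜 in prenex⇔ Φ (team-distribution d) (team-represents p)
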